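{- Let $\mathcal{F}$ be a finite frieze of positive integers of order $n$, and let $s_1$ be its principal growth coefficient. Then $s_1\in\{ -2,0,1\}$. Furthermore, the value of $s_1$ is determined by the order of rotational symmetry of the triangulation of an $n$-gon associated to $\mathcal{F}$ (i.e. finite friezes of positive integers whose associated triangulations have the same order of rotational symmetry have the same value of $s_1$).
   Context: A finite frieze of positive integers of order $n\ge3$ is an array $(m_{i,j})$ indexed by $i\in\mathbb{Z}$, $-2\le j-i\le n-2$, with $m_{i,i-2}=m_{i,i+n-2}=0$, $m_{i,i-1}=m_{i,i+n-3}=1$, with all entries with $-1\le j-i\le n-3$ positive integers, and with $m_{i,j}m_{i+1,j+1}-m_{i,j+1}m_{i+1,j}=1$ whenever all four entries lie in the array. Such a frieze is $n$-periodic ($m_{i+n,j+n}=m_{i,j}$). By Conway and Coxeter it corresponds to a triangulation of a convex $n$-gon: $a_i=m_{i,i}$, $i=1,\dots,n$, is the number of triangles incident with vertex $i$ of the triangulation (vertices taken in anti-clockwise order); this is the associated triangulation. Its order of rotational symmetry is the number of rotations of the regular $n$-gon preserving it. The lattice of the frieze is the unique extension $(m_{i,j})_{i,j\in\mathbb{Z}}$ of the array satisfying $m_{i,j}=-m_{j+2,i-2}$ and $m_{i,j}=-m_{j-n+2,i+n-2}$ for all $i,j\in\mathbb{Z}$ (anti-symmetric mirroring across the rows of zeros). The principal growth coefficient is $s_1:=m_{1,p}-m_{2,p-1}$, where $p$ is the minimal period of the frieze, i.e. the least $p\ge1$ with $m_{i+p,j+p}=m_{i,j}$ for all entries. -}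

module Defs where

open import Data.Bool using (Bool; true)
import Data.Bool.Properties as Bool
open import Data.Fin using (Fin; toℕ; _<_)
open import Data.Fin.Properties using (_≟_; _<?_; all?)
open import Data.Integer as ℤ using (ℤ; +_; -_; _+_; _-_; _*_; _≤_)
open import Data.List using (length; filter; allFin; cartesianProduct)
open import Data.Nat as ℕ using (ℕ; suc)
open import Data.Nat.DivMod using (_mod_)
open import Data.Product using (Σ-syntax; _×_; _,_)
open import Data.Sum using (_⊎_)
open import Relation.Binary.PropositionalEquality using (_≡_; _≢_)
open import Relation.Nullary using (Dec; ¬_)
open import Relation.Nullary.Decidable using (_×-dec_; _⊎-dec_)

InStrip : ℕ → ℤ → ℤ → Set
InStrip n i j = (- + 2 ≤ j - i) × (j - i ≤ + n - + 2)

-- A frieze is an array on the strip only.  It is encoded by a function on ℤ × ℤ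
-- about whose values off the strip nothing is assumed, and which are never used:
-- off the strip one has to pass to the `Lattice` below.
record Frieze (n : ℕ) : Set where
  field
    order≥3     : 3 ℕ.≤ n
    entry       : ℤ → ℤ → ℤ
    zero-lower  : ∀ i → entry i (i - + 2) ≡ + 0
    zero-upper  : ∀ i → entry i (i + + n - + 2) ≡ + 0
    one-lower   : ∀ i → entry i (i - + 1) ≡ + 1
    one-upper   : ∀ i → entry i (i + + n - + 3) ≡ + 1
    positive    : ∀ i j → - + 1 ≤ j - i → j - i ≤ + n - + 3 → + 0 ℤ.< entry i j
    unimodular  : ∀ i j →
                  InStrip n i j → InStrip n (i + + 1) (j + + 1) →
                  InStrip n i (j + + 1) → InStrip n (i + + 1) j →
                  entry i j * entry (i + + 1) (j + + 1)
                    - entry i (j + + 1) * entry (i + + 1) j ≡ + 1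

-- The two mirror laws determine the extension uniquely: the reflections
-- (i , j) ↦ (j + 2 , i - 2) and (i , j) ↦ (j - n + 2 , i + n - 2) in the two
-- rows of zeros generate an infinite dihedral group, with the strip as a
-- fundamental domain.
record Lattice {n : ℕ} (F : Frieze n) : Set where
  open Frieze F using (entry)
  field
    value        : ℤ → ℤ → ℤ
    extends      : ∀ i j → InStrip n i j → value i j ≡ entry i j
    mirror-lower : ∀ i j → value i j ≡ - value (j + + 2) (i - + 2)
    mirror-upper : ∀ i j → value i j ≡ - value (j - + n + + 2) (i + + n - + 2)

IsPeriod : ∀ {n} → Frieze n → ℕ → Set
IsPeriod {n} F p =
  1 ℕ.≤ p × (∀ i j → InStrip n i j → entry (i + + p) (j + + p) ≡ entry i j)
  where open Frieze F using (entry)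

IsMinimalPeriod : ∀ {n} → Frieze n → ℕ → Set
IsMinimalPeriod F p = IsPeriod F p × (∀ q → IsPeriod F q → p ℕ.≤ q)

IsPrincipalGrowthCoefficient : ∀ {n} → Frieze n → ℤ → Set
IsPrincipalGrowthCoefficient F s₁ =
  Σ[ p ∈ ℕ ] Σ[ L ∈ Lattice F ]
    IsMinimalPeriod F p ×
    s₁ ≡ Lattice.value L (+ 1) (+ p) - Lattice.value L (+ 2) (+ p - + 1)

-- The vertices of the n-gon are the elements of Fin n in anti-clockwise order;
-- `rotate k` is the rotation moving every vertex k steps anti-clockwise.
rotate : ∀ {n} → ℕ → Fin n → Fin n
rotate {suc n} k v = (toℕ v ℕ.+ k) mod suc n

Side : ∀ {n} → Fin n → Fin n → Set
Side u v = rotate 1 u ≡ v ⊎ rotate 1 v ≡ u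

Side? : ∀ {n} (u v : Fin n) → Dec (Side u v)
Side? u v = (rotate 1 u ≟ v) ⊎-dec (rotate 1 v ≟ u)

IsDiagonal : ∀ {n} → Fin n → Fin n → Set
IsDiagonal u v = u ≢ v × ¬ Side u v

Inside : ∀ {n} → Fin n → Fin n → Fin n → Set
Inside u v x = (u < x × x < v) ⊎ (v < x × x < u)

Outside : ∀ {n} → Fin n → Fin n → Fin n → Set
Outside u v x = (x < u × x < v) ⊎ (u < x × v < x)

-- The segments uv and xy meet in an interior point of the polygon exactly when
-- x and y lie strictly on different sides of the line through u and v.
Cross : ∀ {n} → Fin n → Fin n → Fin n → Fin n → Set
Cross u v x y = (Inside u v x × Outside u v y) ⊎ (Inside u v y × Outside u v x)

-- A maximal set of pairwise non-crossing diagonals; `diagonal` is the indicator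
-- function of the set, an unordered pair being counted in both orders.
record Triangulation (n : ℕ) : Set where
  field
    diagonal    : Fin n → Fin n → Bool
    symmetric   : ∀ u v → diagonal u v ≡ diagonal v u
    proper      : ∀ u v → diagonal u v ≡ true → IsDiagonal u v
    noncrossing : ∀ u v x y → diagonal u v ≡ true → diagonal x y ≡ true →
                  ¬ Cross u v x y
    maximal     : ∀ u v → IsDiagonal u v →
                  (∀ x y → diagonal x y ≡ true → ¬ Cross u v x y) →
                  diagonal u v ≡ true

module _ {n : ℕ} (T : Triangulation n) where
  open Triangulation T using (diagonal)

  Joined : Fin n → Fin n → Set
  Joined u v = Side u v ⊎ diagonal u v ≡ true

  Joined? : ∀ u v → Dec (Joined u v)
  Joined? u v = Side? u v ⊎-dec (diagonal u v Bool.≟ true)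

  -- Since all vertices lie on the boundary, the triangles of the triangulation
  -- are the triples of pairwise joined vertices.  The triangles incident with u
  -- are counted by their other two vertices, listed in increasing order.
  triangleCount : Fin n → ℕ
  triangleCount u =
    length (filter (λ (v , w) → v <? w ×-dec Joined? u v ×-dec Joined? v w ×-dec Joined? u w)
                   (cartesianProduct (allFin n) (allFin n)))

  Preserves : Fin n → Set
  Preserves k = ∀ u v → diagonal (rotate (toℕ k) u) (rotate (toℕ k) v) ≡ diagonal u v

  Preserves? : ∀ k → Dec (Preserves k)
  Preserves? k = all? λ u → all? λ v →
    diagonal (rotate (toℕ k) u) (rotate (toℕ k) v) Bool.≟ diagonal u v

  rotationalSymmetryOrder : ℕ
  rotationalSymmetryOrder = length (filter Preserves? (allFin n))

-- Entries are indexed by 1, …, n and vertices by 0, …, n - 1, hence the `suc`.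
Associated : ∀ {n} → Frieze n → Triangulation n → Set
Associated {n} F T = (v : Fin n) →
  entry (+ suc (toℕ v)) (+ suc (toℕ v)) ≡ + triangleCount T v
  where open Frieze F using (entry)

{-# OPTIONS --safe #-}

-- The k-th entry of a row of a frieze is a continuant K k of the quiddity (the row
-- of the entries m i i), and K n = 0, K (n - 1) = 1 make the quiddity n-periodic.
-- If p is the minimal period and n = d p, then V j = K (j p) satisfies
-- V (j + 2) = τ V (j + 1) - V j, where τ is the trace of the matrix of one period,
-- and V is positive for 0 < j < d and vanishes at j = 0 and j = d.  For d = 2 this
-- gives τ = 0.  For d ≥ 3 it gives τ > 0; as V increases when τ ≥ 2, τ = 1 and d = 3.
-- For d ≥ 2 the growth coefficient is τ; for d = 1 the mirror law makes it - 2.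
--
-- It remains to see that d is the order of rotational symmetry.  Following the
-- triangles of the triangulation, the entry belonging to a diagonal or side is 1; by
-- Ptolemy's relation crossing chords cannot both have entry 1, so by maximality the
-- entries 1 are exactly the diagonals and sides.  Hence a rotation preserves the
-- triangulation if and only if it preserves the quiddity.

module Submission where

open import Defs
open import Data.Bool using (true)
import Data.Bool.Properties as Bool
open import Data.Empty using (⊥; ⊥-elim)
open import Data.Fin as Fin using (Fin; zero; suc; toℕ)
import Data.Fin.Properties as Fin
open import Data.Integer as ℤ
  using (ℤ; +_; -_; _+_; _-_; _*_; _≤_; +≤+; +<+; 0ℤ; 1ℤ; -[1+_])
import Data.Integer.Properties as ℤ
open import Data.Integer.Tactic.RingSolver using (solve-∀)
open import Algebra.Properties.AbelianGroup ℤ.+-0-abelianGroup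
  using () renaming (∙-cancelˡ to +-cancelˡ)
open import Data.List using (List; []; _∷_; map; length; filter; allFin; cartesianProduct)
open import Data.List.Membership.Propositional using (_∈_)
open import Data.List.Membership.Propositional.Properties
  using (∈-map⁺; ∈-map⁻; ∈-filter⁺; ∈-filter⁻; ∈-cartesianProduct⁺; ∈-allFin)
open import Data.List.Membership.Propositional.Properties.WithK using (unique∧set⇒bag)
open import Data.List.Properties using (length-map; length-tabulate; filter-none)
open import Data.List.Relation.Binary.BagAndSetEquality using (∼bag⇒↭)
open import Data.List.Relation.Binary.Permutation.Propositional.Properties using (↭-length)
open import Data.List.Relation.Unary.All as All using ()
open import Data.List.Relation.Unary.AllPairs using ([]; _∷_)
open import Data.List.Relation.Unary.Any using (here)
open import Data.List.Relation.Unary.Unique.Propositional using (Unique)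
import Data.List.Relation.Unary.Unique.Propositional.Properties as Unique
open import Data.Nat as ℕ using (ℕ; zero; suc; pred; _∸_; _%_; _/_; z≤n; s≤s)
open import Data.Nat.DivMod
  using (_mod_; m<n⇒m%n≡m; n%n≡0; m%n<n; m≡m%n+[m/n]*n; %-distribˡ-+; m%n%n≡m%n; [m+n]%n≡m%n)
open import Data.Nat.Divisibility using (_∣_; divides)
import Data.Nat.Properties as ℕ
open import Data.Product using (∃; ∃₂; _×_; _,_; proj₁; proj₂; swap)
open import Data.Product.Properties using (≡-dec)
open import Data.Sum as Sum using (_⊎_; inj₁; inj₂; [_,_])
open import Function using (_∘_; id; mk⇔)
open import Level using (0ℓ)
open import Relation.Binary.Definitions using (tri<; tri≈; tri>)
open import Relation.Binary.PropositionalEquality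
  using (_≡_; _≢_; refl; sym; trans; cong; cong₂; subst; subst₂; module ≡-Reasoning)
open import Relation.Nullary using (¬_; yes; no)
open import Relation.Nullary.Decidable using (_×-dec_; _⊎-dec_)
open import Relation.Unary using (Pred; Decidable)

-- Continuants

-- Index shifted by one from the classical continuant: `K f (suc k)` is the determinant of the
-- tridiagonal matrix with diagonal `f 0`, ..., `f (k - 1)` and off-diagonal entries 1. Thus `K f k`
-- is a chord spanning k steps, of length 0 for k = 0.
K : (ℕ → ℤ) → ℕ → ℤ
K f 0             = + 0
K f 1             = + 1
K f (suc (suc k)) = f k * K f (suc k) - K f k

infixl 8 _↑_
_↑_ : (ℕ → ℤ) → ℕ → ℕ → ℤ
(f ↑ r) k = f (k ℕ.+ r)

K-cong : ∀ {f g} → (∀ k → f k ≡ g k) → ∀ k → K f k ≡ K g k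
K-cong f≗g 0             = refl
K-cong f≗g 1             = refl
K-cong f≗g (suc (suc k)) =
  cong₂ _-_ (cong₂ _*_ (f≗g k) (K-cong f≗g (suc k))) (K-cong f≗g k)

-- For fixed r, `K f (s + r)` and `K (f ↑ r) s` solve the same second order recurrence in s, so
-- their Casoratian is constant; at s = 0 it equals `K f r`.
euler : ∀ f r s →
  K f (s ℕ.+ r) * K (f ↑ r) (suc s) ≡ K f r + K f (suc (s ℕ.+ r)) * K (f ↑ r) s
euler f r zero    = lemma (K f r) (K f (suc r))
  where
  lemma : ∀ x y → x * + 1 ≡ x + y * + 0
  lemma = solve-∀
euler f r (suc s) = begin
  B * (c * B′ - A′)                  ≡⟨ expand A A′ B B′ c ⟩
  (A * B′ - B * A′) + (c * B - A) * B′ ≡⟨ cong (λ x → x - B * A′ + (c * B - A) * B′) (euler f r s) ⟩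
  (K f r + B * A′ - B * A′) + (c * B - A) * B′ ≡⟨ collect (K f r) (B * A′) _ ⟩
  K f r + (c * B - A) * B′ ∎
  where
  open ≡-Reasoning
  c A B A′ B′ : ℤ
  c  = f (s ℕ.+ r)
  A  = K f (s ℕ.+ r)
  B  = K f (suc (s ℕ.+ r))
  A′ = K (f ↑ r) s
  B′ = K (f ↑ r) (suc s)
  expand : ∀ A A′ B B′ c → B * (c * B′ - A′) ≡ (A * B′ - B * A′) + (c * B - A) * B′
  expand = solve-∀
  collect : ∀ x y z → (x + y - y) + z ≡ x + z
  collect = solve-∀

-- Both sides satisfy the continuant recurrence in t, so t = 0 and t = 1 suffice, the latter being
-- `euler`. The four points are 0, r, s + r and t + s + r, with `K (f ↑ x) y` as the length of the
-- chord from x to x + y.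
ptolemy : ∀ f r s t →
  K f (s ℕ.+ r) * K (f ↑ r) (t ℕ.+ s)
    ≡ K f r * K (f ↑ (s ℕ.+ r)) t + K f (t ℕ.+ (s ℕ.+ r)) * K (f ↑ r) s
ptolemy f r s 0 = lemma (K f r) _
  where
  lemma : ∀ x y → y ≡ x * + 0 + y
  lemma = solve-∀
ptolemy f r s 1 = trans (euler f r s) (cong (_+ K f (suc (s ℕ.+ r)) * K (f ↑ r) s) (sym (ℤ.*-identityʳ (K f r))))
ptolemy f r s (suc (suc t)) = begin
  P * (f (t ℕ.+ s ℕ.+ r) * Y′ - X′)   ≡⟨ cong (λ i → P * (f i * Y′ - X′)) (ℕ.+-assoc t s r) ⟩
  P * (c * Y′ - X′)                   ≡⟨ expand P c X′ Y′ ⟩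
  c * (P * Y′) - P * X′               ≡⟨ cong₂ (λ x y → c * x - y) (ptolemy f r s (suc t)) (ptolemy f r s t) ⟩
  c * (Q * Y″ + Y * R) - (Q * X″ + X * R) ≡⟨ collect Q R X X″ Y Y″ c ⟩
  Q * (c * Y″ - X″) + (c * Y - X) * R ∎
  where
  open ≡-Reasoning
  c P Q R X X′ X″ Y Y′ Y″ : ℤ
  c  = f (t ℕ.+ (s ℕ.+ r))
  P  = K f (s ℕ.+ r)
  Q  = K f r
  R  = K (f ↑ r) s
  X  = K f (t ℕ.+ (s ℕ.+ r))
  Y  = K f (suc t ℕ.+ (s ℕ.+ r))
  X′ = K (f ↑ r) (t ℕ.+ s)
  Y′ = K (f ↑ r) (suc t ℕ.+ s)
  X″ = K (f ↑ (s ℕ.+ r)) t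
  Y″ = K (f ↑ (s ℕ.+ r)) (suc t)
  expand : ∀ P c X Y → P * (c * Y - X) ≡ c * (P * Y) - P * X
  expand = solve-∀
  collect : ∀ Q R X X″ Y Y″ c →
    c * (Q * Y″ + Y * R) - (Q * X″ + X * R) ≡ Q * (c * Y″ - X″) + (c * Y - X) * R
  collect = solve-∀

-- Ptolemy's relation for four points of which the first three are consecutive.
K-left : ∀ f t → K f (suc (suc t)) ≡ f 0 * K (f ↑ 1) (suc t) - K (f ↑ 2) t
K-left f t = begin
  K f (suc (suc t))                   ≡⟨ cong (K f) (ℕ.+-comm 2 t) ⟩
  K f (t ℕ.+ 2)                       ≡⟨ isolate (K (f ↑ 2) t) (K f (t ℕ.+ 2)) ⟩
  (+ 1 * K (f ↑ 2) t + K f (t ℕ.+ 2) * + 1) - K (f ↑ 2) t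
                                      ≡⟨ cong (_- K (f ↑ 2) t) (sym (ptolemy f 1 1 t)) ⟩
  (f 0 * + 1 - + 0) * K (f ↑ 1) (t ℕ.+ 1) - K (f ↑ 2) t
                                      ≡⟨ cong₂ (λ x y → x * K (f ↑ 1) y - K (f ↑ 2) t) (unit (f 0)) (ℕ.+-comm t 1) ⟩
  f 0 * K (f ↑ 1) (suc t) - K (f ↑ 2) t ∎
  where
  open ≡-Reasoning
  isolate : ∀ x y → y ≡ (+ 1 * x + y * + 1) - x
  isolate = solve-∀
  unit : ∀ x → x * + 1 - + 0 ≡ x
  unit = solve-∀

-- The trace of the product of the matrices (f k , -1 ; 1 , 0), 0 ≤ k ≤ p.
trace : (ℕ → ℤ) → ℕ → ℤ
trace f p = K f (suc (suc p)) - K (f ↑ 1) p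

module _ (f : ℕ → ℤ) (p : ℕ) (periodic : ∀ k → f (k ℕ.+ suc p) ≡ f k) where

  -- This is `ptolemy` for the points 0, p + 1, p + 2 and t + p + 2; periodicity turns the
  -- continuants that start one period later back into those of `f` and `f ↑ 1`.
  addition : ∀ t → K f (t ℕ.+ suc (suc p)) ≡
    K f (suc (suc p)) * K f (suc t) - K f (suc p) * K (f ↑ 1) t
  addition t = begin
    K f (t ℕ.+ suc (suc p)) ≡⟨ isolate (K f (suc p) * K (f ↑ suc (suc p)) t) (K f (t ℕ.+ suc (suc p))) ⟩
    (K f (suc p) * K (f ↑ suc (suc p)) t + K f (t ℕ.+ suc (suc p)) * + 1) - K f (suc p) * K (f ↑ suc (suc p)) t
      ≡⟨ cong (_- K f (suc p) * K (f ↑ suc (suc p)) t) (sym (ptolemy f (suc p) 1 t)) ⟩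
    K f (suc (suc p)) * K (f ↑ suc p) (t ℕ.+ 1) - K f (suc p) * K (f ↑ suc (suc p)) t
      ≡⟨ cong₂ (λ x y → K f (suc (suc p)) * x - K f (suc p) * y)
           (trans (cong (K (f ↑ suc p)) (ℕ.+-comm t 1)) (K-cong periodic (suc t)))
           (K-cong (λ k → trans (cong f (sym (ℕ.+-assoc k 1 (suc p)))) (periodic (k ℕ.+ 1))) t) ⟩
    K f (suc (suc p)) * K f (suc t) - K f (suc p) * K (f ↑ 1) t ∎
    where
    open ≡-Reasoning
    isolate : ∀ x y → y ≡ (x + y * + 1) - x
    isolate = solve-∀

  -- Cayley–Hamilton for the matrix of one period.
  trace-recurrence : ∀ k →
    K f (k ℕ.+ (suc p ℕ.+ suc p)) ≡ trace f p * K f (k ℕ.+ suc p) - K f k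
  trace-recurrence 0 = begin
    K f (suc p ℕ.+ suc p)     ≡⟨ cong (K f) (sym (ℕ.+-suc p (suc p))) ⟩
    K f (p ℕ.+ suc (suc p))   ≡⟨ addition p ⟩
    K f (suc (suc p)) * K f (suc p) - K f (suc p) * K (f ↑ 1) p ≡⟨ lemma (K f (suc (suc p))) (K f (suc p)) (K (f ↑ 1) p) ⟩
    trace f p * K f (suc p) - + 0 ∎
    where
    open ≡-Reasoning
    lemma : ∀ x y z → x * y - y * z ≡ (x - z) * y - + 0
    lemma = solve-∀
  trace-recurrence 1 = begin
    K f (suc (suc p ℕ.+ suc p))     ≡⟨ cong (K f) (sym (ℕ.+-suc (suc p) (suc p))) ⟩
    K f (suc p ℕ.+ suc (suc p))   ≡⟨ addition (suc p) ⟩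
    K f (suc (suc p)) * K f (suc (suc p)) - K f (suc p) * K (f ↑ 1) (suc p)
      ≡⟨ cong (λ x → K f (suc (suc p)) * K f (suc (suc p)) - x) euler₁ ⟩
    K f (suc (suc p)) * K f (suc (suc p)) - (+ 1 + K f (suc (suc p)) * K (f ↑ 1) p) ≡⟨ lemma (K f (suc (suc p))) (K (f ↑ 1) p) ⟩
    trace f p * K f (suc (suc p)) - + 1 ∎
    where
    open ≡-Reasoning
    -- The matrix of one period has determinant 1.
    euler₁ : K f (suc p) * K (f ↑ 1) (suc p) ≡ + 1 + K f (suc (suc p)) * K (f ↑ 1) p
    euler₁ = subst (λ q → K f q * K (f ↑ 1) (suc p) ≡ + 1 + K f (suc q) * K (f ↑ 1) p)
               (ℕ.+-comm p 1) (euler f 1 p)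
    lemma : ∀ x z → x * x - (+ 1 + x * z) ≡ (x - z) * x - + 1
    lemma = solve-∀
  trace-recurrence (suc (suc k)) = begin
    f (k ℕ.+ (suc p ℕ.+ suc p)) * K f (suc k ℕ.+ (suc p ℕ.+ suc p)) - K f (k ℕ.+ (suc p ℕ.+ suc p))
      ≡⟨ cong₂ _-_ (cong₂ _*_ twice (trace-recurrence (suc k))) (trace-recurrence k) ⟩
    f k * (τ * K f (suc k ℕ.+ suc p) - K f (suc k)) - (τ * K f (k ℕ.+ suc p) - K f k)
      ≡⟨ lemma (f k) τ _ _ _ _ ⟩
    τ * (f k * K f (suc k ℕ.+ suc p) - K f (k ℕ.+ suc p)) - (f k * K f (suc k) - K f k)
      ≡⟨ cong (λ x → τ * (x * K f (suc k ℕ.+ suc p) - K f (k ℕ.+ suc p)) - (f k * K f (suc k) - K f k)) (sym (periodic k)) ⟩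
    τ * K f (suc (suc k) ℕ.+ suc p) - K f (suc (suc k)) ∎
    where
    open ≡-Reasoning
    τ : ℤ
    τ = trace f p
    twice : f (k ℕ.+ (suc p ℕ.+ suc p)) ≡ f k
    twice = trans (cong f (sym (ℕ.+-assoc k (suc p) (suc p)))) (trans (periodic _) (periodic k))
    lemma : ∀ c τ x y z w → c * (τ * x - y) - (τ * z - w) ≡ τ * (c * x - z) - (c * y - w)
    lemma = solve-∀

-- Friezes as continuants of their first row

module Continuants {m : ℕ} (F : Frieze (suc (suc m))) where
  open Frieze F

  n : ℕ
  n = suc (suc m)

  quiddity : ℤ → ℤ
  quiddity i = entry i i

  from : ℤ → ℕ → ℤ
  from i k = quiddity (i + + k)

  from-↑ : ∀ i r k → (from i ↑ r) k ≡ from (i + + r) k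
  from-↑ i r k = cong quiddity (begin
    i + + (k ℕ.+ r)   ≡⟨ cong (λ x → i + x) (ℤ.pos-+ k r) ⟩
    i + (+ k + + r)   ≡⟨ lemma i (+ k) (+ r) ⟩
    i + + r + + k     ∎)
    where
    open ≡-Reasoning
    lemma : ∀ i k r → i + (k + r) ≡ i + r + k
    lemma = solve-∀

  -- The k-th entry of row i, the rows of zeros being k = 0 and k = n.
  col : ℤ → ℕ → ℤ
  col i k = i - + 2 + + k

  col-diff : ∀ i k → col i k - i ≡ + k - + 2
  col-diff i k = lemma i (+ k)
    where
    lemma : ∀ i k → i - + 2 + k - i ≡ k - + 2
    lemma = solve-∀

  col-in-strip : ∀ i {k} → k ℕ.≤ n → InStrip n i (col i k)
  col-in-strip i {k} k≤n rewrite col-diff i k =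
    ℤ.+-monoˡ-≤ (- + 2) (+≤+ {0} {k} z≤n) , ℤ.+-monoˡ-≤ (- + 2) (+≤+ k≤n)

  col-positive : ∀ i {k} → k ℕ.< suc m → + 0 ℤ.< entry i (col i (suc k))
  col-positive i {k} k<1+m = positive i (col i (suc k))
    (subst (- + 1 ≤_) (sym (col-diff i (suc k))) (ℤ.+-monoˡ-≤ (- + 2) (+≤+ {1} {suc k} (s≤s z≤n))))
    (subst₂ _≤_ (sym (col-diff i (suc k))) (lemma (+ n))
      (ℤ.+-monoˡ-≤ (- + 2) {y = + n - + 1} (+≤+ k<1+m)))
    where
    lemma : ∀ n → n - + 1 - + 2 ≡ n - + 3
    lemma = solve-∀

  col-suc : ∀ i k → col i (suc k) ≡ col i k + + 1
  col-suc i k = trans (cong (λ x → i - + 2 + x) (cong +_ (ℕ.+-comm 1 k))) (sym (ℤ.+-assoc (i - + 2) (+ k) (+ 1)))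

  suc-col : ∀ i k → col (i + + 1) k ≡ col i k + + 1
  suc-col i k = lemma i (+ k)
    where
    lemma : ∀ i k → i + + 1 - + 2 + k ≡ i - + 2 + k + + 1
    lemma = solve-∀

  diamond : ∀ i k → suc (suc k) ℕ.≤ n →
    entry i (col i (suc k)) * entry (i + + 1) (col (i + + 1) (suc k))
      ≡ 1ℤ + entry i (col i (suc (suc k))) * entry (i + + 1) (col (i + + 1) k)
  diamond i k 2+k≤n = begin
    x * y             ≡⟨ lemma x y (z * w) ⟩
    (x * y - z * w) + z * w ≡⟨ cong (_+ z * w) unimodular′ ⟩
    1ℤ + z * w ∎
    where
    open ≡-Reasoning
    x y z w : ℤ
    x = entry i (col i (suc k))
    y = entry (i + + 1) (col (i + + 1) (suc k))
    z = entry i (col i (suc (suc k)))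
    w = entry (i + + 1) (col (i + + 1) k)
    lemma : ∀ x y z → x * y ≡ (x * y - z) + z
    lemma = solve-∀
    j+1≡ : col (i + + 1) (suc k) ≡ col i (suc k) + + 1
    j+1≡ = suc-col i (suc k)
    j≡ : col (i + + 1) k ≡ col i (suc k)
    j≡ = trans (suc-col i k) (sym (col-suc i k))
    unimodular′ : x * y - z * w ≡ 1ℤ
    unimodular′ rewrite j+1≡ | j≡ | col-suc i (suc k) =
      unimodular i (col i (suc k))
        (col-in-strip i (ℕ.<⇒≤ 2+k≤n))
        (subst (InStrip n (i + + 1)) j+1≡ (col-in-strip (i + + 1) (ℕ.<⇒≤ 2+k≤n)))
        (subst (InStrip n i) (col-suc i (suc k)) (col-in-strip i 2+k≤n))
        (subst (InStrip n (i + + 1)) j≡ (col-in-strip (i + + 1) (ℕ.<⇒≤ (ℕ.<⇒≤ 2+k≤n))))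

  -- Both sides satisfy the unimodular rule, which determines an entry of row i
  -- from the rest because the entry it is multiplied by is positive.
  entry≡K : ∀ k → k ℕ.≤ n → ∀ i → entry i (col i k) ≡ K (from i) k
  entry≡K 0 _ i = trans (cong (entry i) (ℤ.+-identityʳ (i - + 2))) (zero-lower i)
  entry≡K 1 _ i = trans (cong (entry i) (lemma i)) (one-lower i)
    where
    lemma : ∀ i → i - + 2 + + 1 ≡ i - + 1
    lemma = solve-∀
  entry≡K 2 _ i = trans (cong₂ entry (lemma₁ i) (lemma₂ i)) (lemma₃ (quiddity (i + + 0)))
    where
    lemma₁ : ∀ i → i ≡ i + + 0
    lemma₁ = solve-∀
    lemma₂ : ∀ i → i - + 2 + + 2 ≡ i + + 0
    lemma₂ = solve-∀
    lemma₃ : ∀ x → x ≡ x * + 1 - + 0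
    lemma₃ = solve-∀
  entry≡K (suc (suc (suc k))) 3+k≤n@(s≤s 2+k≤1+m) i =
    ℤ.*-cancelʳ-≡ _ _ w {{ℤ.>-nonZero (col-positive (i + + 1) {k} (ℕ.<⇒≤ 2+k≤1+m))}} (+-cancelˡ 1ℤ _ _ (begin
      1ℤ + entry i (col i (3 ℕ.+ k)) * w       ≡⟨ diamond i (suc k) 3+k≤n ⟨
      entry i (col i (2 ℕ.+ k)) * entry (i + + 1) (col (i + + 1) (2 ℕ.+ k))
        ≡⟨ cong₂ _*_ (entry≡K (suc (suc k)) (ℕ.<⇒≤ 3+k≤n) i) (entry≡K (suc (suc k)) (ℕ.<⇒≤ 3+k≤n) (i + + 1)) ⟩
      K (from i) (2 ℕ.+ k) * K (from (i + + 1)) (2 ℕ.+ k)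
        ≡⟨ cong (λ x → K (from i) (2 ℕ.+ k) * x) (sym (K-cong (from-↑ i 1) (2 ℕ.+ k))) ⟩
      K (from i) (2 ℕ.+ k) * K (from i ↑ 1) (2 ℕ.+ k)
        ≡⟨ cong (λ q → K (from i) q * K (from i ↑ 1) (2 ℕ.+ k)) (ℕ.+-comm 1 (suc k)) ⟩
      K (from i) (suc k ℕ.+ 1) * K (from i ↑ 1) (2 ℕ.+ k)
        ≡⟨ euler (from i) 1 (suc k) ⟩
      1ℤ + K (from i) (suc (suc k ℕ.+ 1)) * K (from i ↑ 1) (suc k)
        ≡⟨ cong₂ (λ q x → 1ℤ + K (from i) (suc q) * x) (ℕ.+-comm (suc k) 1) (K-cong (from-↑ i 1) (suc k)) ⟩
      1ℤ + K (from i) (3 ℕ.+ k) * K (from (i + + 1)) (suc k)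
        ≡⟨ cong (λ x → 1ℤ + K (from i) (3 ℕ.+ k) * x) (sym (entry≡K (suc k) (ℕ.<⇒≤ (ℕ.<⇒≤ 3+k≤n)) (i + + 1))) ⟩
      1ℤ + K (from i) (3 ℕ.+ k) * w ∎))
    where
    open ≡-Reasoning
    w : ℤ
    w = entry (i + + 1) (col (i + + 1) (suc k))

  K-positive : ∀ i {k} → k ℕ.< suc m → + 0 ℤ.< K (from i) (suc k)
  K-positive i {k} k<1+m = subst (+ 0 ℤ.<_) (entry≡K (suc k) (ℕ.m≤n⇒m≤1+n k<1+m) i) (col-positive i k<1+m)

  K-last : ∀ i → K (from i) (suc m) ≡ + 1
  K-last i = trans (sym (entry≡K (suc m) (ℕ.n≤1+n _) i)) (trans (cong (entry i) (begin
    i - + 2 + + suc m         ≡⟨ cong (λ x → i - + 2 + x) (ℤ.pos-+ 1 m) ⟩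
    i - + 2 + (+ 1 + + m)     ≡⟨ lemma i (+ m) ⟩
    i + (+ 2 + + m) - + 3     ≡⟨ cong (λ x → i + x - + 3) (sym (ℤ.pos-+ 2 m)) ⟩
    i + + n - + 3             ∎)) (one-upper i))
    where
    open ≡-Reasoning
    lemma : ∀ i m → i - + 2 + (+ 1 + m) ≡ i + (+ 2 + m) - + 3
    lemma = solve-∀

  K-zero : ∀ i → K (from i) n ≡ + 0
  K-zero i = trans (sym (entry≡K n ℕ.≤-refl i)) (trans (cong (entry i) (lemma i (+ n))) (zero-upper i))
    where
    lemma : ∀ i n → i - + 2 + n ≡ i + n - + 2
    lemma = solve-∀

  -- Both sides equal `K (from (i + + 2)) m`: a row vanishes at n and has 1 at n - 1, so expanding
  -- the zero of row i + 2 at its last term gives one equality and expanding the zero of row i at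
  -- its first term gives the other.
  quiddity-periodic : ∀ i → quiddity (i + + n) ≡ quiddity i
  quiddity-periodic i = begin
    quiddity (i + + n)                     ≡⟨ cong quiddity (trans (cong (λ x → i + x) (ℤ.pos-+ 2 m)) (sym (ℤ.+-assoc i (+ 2) (+ m)))) ⟩
    from (i + + 2) m                       ≡⟨ ℤ.*-identityʳ _ ⟨
    from (i + + 2) m * + 1                 ≡⟨ cong (from (i + + 2) m *_) (K-last (i + + 2)) ⟨
    from (i + + 2) m * K (from (i + + 2)) (suc m)
                                           ≡⟨ ℤ.i-j≡0⇒i≡j _ _ (K-zero (i + + 2)) ⟩
    K (from (i + + 2)) m                   ≡⟨ K-cong (from-↑ i 2) m ⟨
    K (from i ↑ 2) m                       ≡⟨ ℤ.i-j≡0⇒i≡j _ _ (trans (sym (K-left (from i) m)) (K-zero i)) ⟨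
    from i 0 * K (from i ↑ 1) (suc m)      ≡⟨ cong (from i 0 *_) (trans (K-cong (from-↑ i 1) (suc m)) (K-last (i + + 1))) ⟩
    from i 0 * + 1                         ≡⟨ ℤ.*-identityʳ _ ⟩
    from i 0                               ≡⟨ cong quiddity (ℤ.+-identityʳ i) ⟩
    quiddity i                             ∎
    where open ≡-Reasoning

  -- The glide reflection of the frieze: the two arcs cut off by a chord carry the same entry. In
  -- `euler` the factor at n is 0 and the factor at n - 1 is 1.
  glide : ∀ i r s → s ℕ.+ r ≡ n → K (from i) r ≡ K (from (i + + r)) s
  glide i r 0       refl = K-zero i
  glide i r (suc s) eq   = begin
    K (from i) r                     ≡⟨ ℤ.+-identityʳ _ ⟨
    K (from i) r + 0ℤ * K (from i ↑ r) s
      ≡⟨ cong (λ x → K (from i) r + x * K (from i ↑ r) s) (trans (cong (K (from i)) eq) (K-zero i)) ⟨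
    K (from i) r + K (from i) (suc (s ℕ.+ r)) * K (from i ↑ r) s
      ≡⟨ euler (from i) r s ⟨
    K (from i) (s ℕ.+ r) * K (from i ↑ r) (suc s)
      ≡⟨ cong₂ _*_ (trans (cong (K (from i)) (ℕ.suc-injective eq)) (K-last i)) (K-cong (from-↑ i r) (suc s)) ⟩
    1ℤ * K (from (i + + r)) (suc s)  ≡⟨ ℤ.*-identityˡ _ ⟩
    K (from (i + + r)) (suc s)       ∎
    where open ≡-Reasoning

-- Periods and the growth coefficient

-- The growth coefficient of a frieze whose order is d times its minimal period,
-- where d = 1, 2, 3 are the only possibilities.
coefficient : ℕ → ℤ
-- An arbitrary admissible default: d = 0 would make the order 0.
coefficient 0 = + 1
coefficient 1 = - + 2
coefficient 2 = + 0
-- All d from 3 on share the value 1, which `first-zero` derives for them at once.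
coefficient (suc (suc (suc _))) = + 1

-- V is a Chebyshev sequence in τ, up to the factor V 1.
module _ (V : ℕ → ℤ) (τ : ℤ) (V₀ : V 0 ≡ + 0)
         (step : ∀ j → V (suc (suc j)) ≡ τ * V (suc j) - V j) where

  V₂ : V 2 ≡ τ * V 1
  V₂ = trans (step 0) (trans (cong (λ x → τ * V 1 - x) V₀) (ℤ.+-identityʳ _))

  -- For τ at least 2 the recurrence bounds V (j + 2) below by 2 V (j + 1) - V j, so the increments
  -- never shrink and the initial rise from 0 persists.
  increasing : + 2 ≤ τ → + 0 ℤ.< V 1 → ∀ j → + 0 ≤ V j × V j ℤ.< V (suc j)
  increasing 2≤τ V₁>0 0 = ℤ.≤-reflexive (sym V₀) , subst (ℤ._< V 1) (sym V₀) V₁>0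
  increasing 2≤τ V₁>0 (suc j) with 0≤Vⱼ , Vⱼ<Vⱼ₊₁ ← increasing 2≤τ V₁>0 j =
    0≤Vⱼ₊₁ , (begin-strict
      V (suc j)                               ≡⟨ lemma (V j) (V (suc j)) ⟩
      V (suc j) + V j - V j                   <⟨ ℤ.+-monoˡ-< (- V j) (ℤ.+-monoʳ-< (V (suc j)) Vⱼ<Vⱼ₊₁) ⟩
      V (suc j) + V (suc j) - V j             ≡⟨ lemma′ (V j) (V (suc j)) ⟩
      + 2 * V (suc j) - V j                   ≤⟨ ℤ.+-monoˡ-≤ (- V j) (ℤ.*-monoʳ-≤-nonNeg (V (suc j)) {{ℤ.nonNegative 0≤Vⱼ₊₁}} 2≤τ) ⟩
      τ * V (suc j) - V j                     ≡⟨ step j ⟨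
      V (suc (suc j))                         ∎)
    where
    open ℤ.≤-Reasoning
    0≤Vⱼ₊₁ : + 0 ≤ V (suc j)
    0≤Vⱼ₊₁ = ℤ.<⇒≤ (ℤ.≤-<-trans 0≤Vⱼ Vⱼ<Vⱼ₊₁)
    lemma : ∀ x y → y ≡ y + x - x
    lemma = solve-∀
    lemma′ : ∀ x y → y + y - x ≡ + 2 * y - x
    lemma′ = solve-∀

  -- The sign of τ is read off from V 2 = τ V 1. If V 2 is already the zero, τ = 0. Otherwise V 2 >
  -- 0 makes τ positive, while the return to 0 contradicts `increasing` unless τ < 2; integrality
  -- leaves 1.
  first-zero : ∀ d → (∀ {j} → 0 ℕ.< j → j ℕ.< suc (suc d) → + 0 ℤ.< V j) →
               V (suc (suc d)) ≡ + 0 → τ ≡ coefficient (suc (suc d))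
  first-zero zero pos V₂≡0 with ℤ.i*j≡0⇒i≡0∨j≡0 τ (trans (sym V₂) V₂≡0)
  ... | inj₁ τ≡0  = τ≡0
  ... | inj₂ V₁≡0 = ⊥-elim (ℤ.<-irrefl (sym V₁≡0) (pos (s≤s z≤n) (s≤s (s≤s z≤n))))
  first-zero (suc d) pos Vₘ≡0 = go τ refl
    where
    V₁>0 : + 0 ℤ.< V 1
    V₁>0 = pos (s≤s z≤n) (s≤s (s≤s z≤n))
    0<τ : + 0 ℤ.< τ
    0<τ = ℤ.*-cancelʳ-<-nonNeg (V 1) {{ℤ.nonNegative (ℤ.<⇒≤ V₁>0)}}
            (subst₂ ℤ._<_ (sym (ℤ.*-zeroˡ (V 1))) V₂ (pos (s≤s z≤n) (s≤s (s≤s (s≤s z≤n)))))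
    go : ∀ t → τ ≡ t → t ≡ + 1
    go (+ 0) τ≡t = ⊥-elim (ℤ.<-irrefl (sym τ≡t) 0<τ)
    go (+ 1) τ≡t = refl
    go (+ suc (suc t)) τ≡t with _ , Vₘ₋₁<Vₘ ← increasing (subst (+ 2 ≤_) (sym τ≡t) (+≤+ (s≤s (s≤s z≤n)))) V₁>0 (suc (suc d)) =
      ⊥-elim (ℤ.<-asym (subst (V (suc (suc d)) ℤ.<_) Vₘ≡0 Vₘ₋₁<Vₘ) (pos (s≤s z≤n) ℕ.≤-refl))
    go (-[1+ t ]) τ≡t with () ← subst (+ 0 ℤ.<_) τ≡t 0<τ

module Periods {m : ℕ} (F : Frieze (suc (suc m))) where
  open Frieze F
  open Continuants F public

  Shift : ℕ → Set
  Shift q = ∀ i → quiddity (i + + q) ≡ quiddity i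

  from-shift : ∀ {q} → Shift q → ∀ i k → from (i + + q) k ≡ from i k
  from-shift {q} shift i k = trans (cong quiddity (lemma i (+ q) (+ k))) (shift (i + + k))
    where
    lemma : ∀ i q k → i + q + k ≡ i + k + q
    lemma = solve-∀

  shift-0 : Shift 0
  shift-0 i = cong quiddity (ℤ.+-identityʳ i)

  shift-+ : ∀ q r → Shift q → Shift r → Shift (q ℕ.+ r)
  shift-+ q r shift-q shift-r i =
    trans (cong quiddity (trans (cong (λ x → i + x) (ℤ.pos-+ q r)) (sym (ℤ.+-assoc i (+ q) (+ r)))))
          (trans (shift-r (i + + q)) (shift-q i))

  shift-* : ∀ d q → Shift q → Shift (d ℕ.* q)
  shift-* zero    q shift-q = shift-0
  shift-* (suc d) q shift-q = shift-+ q (d ℕ.* q) shift-q (shift-* d q shift-q)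

  shift-cancelˡ : ∀ q r → Shift q → Shift (q ℕ.+ r) → Shift r
  shift-cancelˡ q r shift-q shift-q+r i = begin
    quiddity (i + + r)             ≡⟨ shift-q (i + + r) ⟨
    quiddity (i + + r + + q)       ≡⟨ cong quiddity (trans (lemma i (+ q) (+ r)) (cong (λ x → i + x) (sym (ℤ.pos-+ q r)))) ⟩
    quiddity (i + + (q ℕ.+ r))     ≡⟨ shift-q+r i ⟩
    quiddity i                     ∎
    where
    open ≡-Reasoning
    lemma : ∀ i q r → i + r + q ≡ i + (q + r)
    lemma = solve-∀

  isPeriod⇒shift : ∀ {q} → IsPeriod F q → Shift q
  isPeriod⇒shift (_ , periodic) i = periodic i i
    (subst (- + 2 ≤_) (sym (ℤ.i≡j⇒i-j≡0 {i} refl)) ℤ.-≤+ , subst (_≤ + n - + 2) (sym (ℤ.i≡j⇒i-j≡0 {i} refl)) (+≤+ z≤n))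

  shift⇒isPeriod : ∀ {q} → 1 ℕ.≤ q → Shift q → IsPeriod F q
  shift⇒isPeriod {q} 1≤q shift = 1≤q , periodic
    where
    periodic : ∀ i j → InStrip n i j → entry (i + + q) (j + + q) ≡ entry i j
    periodic i j (lower , upper) = begin
      entry (i + + q) (j + + q)           ≡⟨ cong (entry (i + + q)) j+q≡ ⟩
      entry (i + + q) (col (i + + q) k)   ≡⟨ entry≡K k k≤n (i + + q) ⟩
      K (from (i + + q)) k                ≡⟨ K-cong (from-shift shift i) k ⟩
      K (from i) k                        ≡⟨ entry≡K k k≤n i ⟨
      entry i (col i k)                   ≡⟨ cong (entry i) j≡ ⟨
      entry i j                           ∎
      where
      open ≡-Reasoning
      k : ℕ
      k = ℤ.∣ j - i + + 2 ∣
      +k≡ : + k ≡ j - i + + 2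
      +k≡ = ℤ.0≤i⇒+∣i∣≡i (ℤ.+-monoˡ-≤ (+ 2) lower)
      k≤n : k ℕ.≤ n
      k≤n = ℤ.drop‿+≤+ (subst₂ _≤_ (sym +k≡) (cong +_ (ℕ.+-comm m 2)) (ℤ.+-monoˡ-≤ (+ 2) upper))
      lemma : ∀ i j → j ≡ i - + 2 + (j - i + + 2)
      lemma = solve-∀
      j≡ : j ≡ col i k
      j≡ = trans (lemma i j) (cong (λ x → i - + 2 + x) (sym +k≡))
      lemma′ : ∀ i k q → i - + 2 + k + q ≡ i + q - + 2 + k
      lemma′ = solve-∀
      j+q≡ : j + + q ≡ col (i + + q) k
      j+q≡ = trans (cong (_+ + q) j≡) (lemma′ i (+ k) (+ q))

  module Minimal (p : ℕ) (minimal : IsMinimalPeriod F (suc p)) where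

    shift-p : Shift (suc p)
    shift-p = isPeriod⇒shift (proj₁ minimal)

    -- The remainder of q modulo the minimal period is again a shift; were it positive, it would be
    -- a smaller period.
    shift⇒∣ : ∀ {q} → Shift q → suc p ∣ q
    shift⇒∣ {q} shift with q % suc p in r≡
    ... | zero  = divides (q / suc p) (trans (m≡m%n+[m/n]*n q (suc p)) (cong (ℕ._+ q / suc p ℕ.* suc p) r≡))
    ... | suc r = ⊥-elim (ℕ.<⇒≱ (subst (ℕ._< suc p) r≡ (m%n<n q (suc p)))
                    (proj₂ minimal (suc r) (shift⇒isPeriod (s≤s z≤n)
                      (shift-cancelˡ (q / suc p ℕ.* suc p) (suc r) (shift-* (q / suc p) (suc p) shift-p)
                        (subst Shift (trans (m≡m%n+[m/n]*n q (suc p)) (trans (cong (ℕ._+ q / suc p ℕ.* suc p) r≡) (ℕ.+-comm (suc r) _))) shift)))))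

    trace≡coefficient : ∀ d → suc (suc d) ℕ.* suc p ≡ n →
      trace (from (+ 1)) p ≡ coefficient (suc (suc d))
    trace≡coefficient d eq = first-zero V (trace (from (+ 1)) p) refl step d V-positive V-zero
      where
      V : ℕ → ℤ
      V j = K (from (+ 1)) (j ℕ.* suc p)
      step : ∀ j → V (suc (suc j)) ≡ trace (from (+ 1)) p * V (suc j) - V j
      step j = begin
        K (from (+ 1)) (suc p ℕ.+ (suc p ℕ.+ j ℕ.* suc p))
          ≡⟨ cong (K (from (+ 1))) (trans (sym (ℕ.+-assoc (suc p) (suc p) (j ℕ.* suc p))) (ℕ.+-comm (suc p ℕ.+ suc p) (j ℕ.* suc p))) ⟩
        K (from (+ 1)) (j ℕ.* suc p ℕ.+ (suc p ℕ.+ suc p))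
          ≡⟨ trace-recurrence (from (+ 1)) p (λ k → trans (from-↑ (+ 1) (suc p) k) (from-shift shift-p (+ 1) k)) (j ℕ.* suc p) ⟩
        trace (from (+ 1)) p * K (from (+ 1)) (j ℕ.* suc p ℕ.+ suc p) - V j
          ≡⟨ cong (λ q → trace (from (+ 1)) p * K (from (+ 1)) q - V j) (ℕ.+-comm (j ℕ.* suc p) (suc p)) ⟩
        trace (from (+ 1)) p * V (suc j) - V j ∎
        where open ≡-Reasoning
      V-positive : ∀ {j} → 0 ℕ.< j → j ℕ.< suc (suc d) → + 0 ℤ.< V j
      V-positive {suc j} _ j<d = K-positive (+ 1) {p ℕ.+ j ℕ.* suc p}
        (ℕ.s≤s⁻¹ (subst (suc j ℕ.* suc p ℕ.<_) eq (ℕ.*-monoˡ-< (suc p) j<d)))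
      V-zero : V (suc (suc d)) ≡ + 0
      V-zero = trans (cong (K (from (+ 1))) eq) (K-zero (+ 1))

    module _ (L : Lattice F) where
      open Lattice L

      growth : ∀ d → n ≡ d ℕ.* suc p →
        value (+ 1) (+ suc p) - value (+ 2) (+ suc p - + 1) ≡ coefficient d
      -- When the period is n, the entry (1, n) lies just above the strip. The mirror law makes it
      -- minus the entry (2, n - 1), which is in the upper row of ones, whence - 1 - 1.
      growth 1 n≡ = begin
        value (+ 1) (+ suc p) - value (+ 2) (+ p)
          ≡⟨ cong (λ q → value (+ 1) (+ suc q) - value (+ 2) (+ q)) p≡ ⟩
        value (+ 1) (+ n) - value (+ 2) (+ suc m)
          ≡⟨ cong (_- value (+ 2) (+ suc m)) (mirror-upper (+ 1) (+ n)) ⟩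
        - value (+ n - + n + + 2) (+ suc m) - value (+ 2) (+ suc m)
          ≡⟨ cong (λ i → - value (i + + 2) (+ suc m) - value (+ 2) (+ suc m)) (ℤ.i≡j⇒i-j≡0 {+ n} refl) ⟩
        - value (+ 2) (+ suc m) - value (+ 2) (+ suc m)
          ≡⟨ cong (λ x → - x - x) (trans (extends (+ 2) (+ suc m) (col-in-strip (+ 2) (ℕ.n≤1+n (suc m))))
               (trans (entry≡K (suc m) (ℕ.n≤1+n (suc m)) (+ 2)) (K-last (+ 2)))) ⟩
        - + 2 ∎
        where
        open ≡-Reasoning
        p≡ : p ≡ suc m
        p≡ = ℕ.suc-injective (trans (sym (ℕ.*-identityˡ (suc p))) (sym n≡))
      -- At least two periods fit into n, so both entries lie in the strip, at positions p + 2 of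
      -- row 1 and p of row 2; their difference is the trace of one period by definition.
      growth (suc (suc d)) n≡ = begin
        value (+ 1) (+ suc p) - value (+ 2) (+ p)
          ≡⟨ cong₂ _-_ (value≡K (+ 1) (suc (suc p)) 2+p≤n) (value≡K (+ 2) p (ℕ.<⇒≤ (ℕ.<⇒≤ 2+p≤n))) ⟩
        K (from (+ 1)) (suc (suc p)) - K (from (+ 2)) p
          ≡⟨ cong (λ x → K (from (+ 1)) (suc (suc p)) - x) (sym (K-cong (from-↑ (+ 1) 1) p)) ⟩
        trace (from (+ 1)) p ≡⟨ trace≡coefficient d (sym n≡) ⟩
        coefficient (suc (suc d)) ∎
        where
        open ≡-Reasoning
        value≡K : ∀ i k → k ℕ.≤ n → value i (col i k) ≡ K (from i) k
        value≡K i k k≤n = trans (extends i (col i k) (col-in-strip i k≤n)) (entry≡K k k≤n i)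
        2+p≤n : suc (suc p) ℕ.≤ n
        2+p≤n = subst (suc (suc p) ℕ.≤_) (sym n≡) (s≤s (ℕ.≤-trans (ℕ.≤-reflexive (ℕ.+-comm 1 p)) (ℕ.+-monoʳ-≤ p (s≤s z≤n))))

-- Counting on lists

-- Lists without repetition that have the same members are permutations of each other, so counting
-- reduces to a comparison of membership.
length-bijection : ∀ {A B : Set} {xs : List A} {ys : List B} (g : A → B) →
  Unique xs → Unique ys → (∀ {x y} → g x ≡ g y → x ≡ y) →
  (∀ {x} → x ∈ xs → g x ∈ ys) → (∀ {y} → y ∈ ys → ∃ λ x → x ∈ xs × y ≡ g x) →
  length xs ≡ length ys
length-bijection {xs = xs} {ys} g uxs uys g-injective to from =
  trans (sym (length-map g xs))
    (↭-length (∼bag⇒↭ (unique∧set⇒bag (Unique.map⁺ g-injective uxs) uys (mk⇔ to′ from′))))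
  where
  to′ : ∀ {y} → y ∈ map g xs → y ∈ ys
  to′ y∈ with x , x∈xs , refl ← ∈-map⁻ g y∈ = to x∈xs
  from′ : ∀ {y} → y ∈ ys → y ∈ map g xs
  from′ y∈ with x , x∈xs , refl ← from y∈ = ∈-map⁺ g x∈xs

length-filter-⊎ : ∀ {A : Set} {P Q R : Pred A 0ℓ} (P? : Decidable P) (Q? : Decidable Q) (R? : Decidable R) →
  (∀ {x} → P x → Q x ⊎ R x) → (∀ {x} → Q x → P x) → (∀ {x} → R x → P x) →
  (∀ {x} → Q x → ¬ R x) → ∀ xs →
  length (filter P? xs) ≡ length (filter Q? xs) ℕ.+ length (filter R? xs)
length-filter-⊎ P? Q? R? split Q⇒P R⇒P disjoint [] = refl
length-filter-⊎ P? Q? R? split Q⇒P R⇒P disjoint (x ∷ xs)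
  with ih ← length-filter-⊎ P? Q? R? split Q⇒P R⇒P disjoint xs | P? x | Q? x | R? x
... | yes _ | yes _ | no _  = cong suc ih
... | yes _ | no _  | yes _ = trans (cong suc ih) (sym (ℕ.+-suc _ _))
... | no _  | no _  | no _  = ih
... | _     | yes q | yes r = ⊥-elim (disjoint q r)
... | yes p | no ¬q | no ¬r = ⊥-elim ([ ¬q , ¬r ] (split p))
... | no ¬p | yes q | no _  = ⊥-elim (¬p (Q⇒P q))
... | no ¬p | no _  | yes r = ⊥-elim (¬p (R⇒P r))

maximum : ∀ {n} {P : Pred (Fin n) 0ℓ} → Decidable P → ∃ P → ∃ λ w → P w × (∀ x → P x → x Fin.≤ w)
maximum {suc n} P? ∃P with Fin.any? (P? ∘ suc) | ∃P
... | yes ∃P∘suc | _ with w , Pw , w-max ← maximum (P? ∘ suc) ∃P∘suc =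
  suc w , Pw , λ { zero _ → z≤n ; (suc x) Px → s≤s (w-max x Px) }
maximum {suc n} P? ∃P | no ¬∃P∘suc | zero  , P0 =
  zero , P0 , λ { zero _ → z≤n ; (suc x) Px → ⊥-elim (¬∃P∘suc (x , Px)) }
maximum {suc n} P? ∃P | no ¬∃P∘suc | suc x , Px = ⊥-elim (¬∃P∘suc (x , Px))

-- Triangulations

toℕ-surjective : ∀ {n i} → i ℕ.< n → ∃ λ (x : Fin n) → i ≡ toℕ x
toℕ-surjective i<n = Fin.fromℕ< i<n , sym (Fin.toℕ-fromℕ< i<n)

toℕ-rotate : ∀ {n} k (v : Fin (suc n)) → toℕ (rotate k v) ≡ (toℕ v ℕ.+ k) % suc n
toℕ-rotate {n} k v = Fin.toℕ-fromℕ< _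

rotate-1 : ∀ {n} {u v : Fin (suc n)} → rotate 1 u ≡ v →
  suc (toℕ u) ≡ toℕ v ⊎ (toℕ u ≡ n × toℕ v ≡ 0)
rotate-1 {n} {u} refl with ℕ.m≤n⇒m<n∨m≡n (Fin.toℕ<n u)
... | inj₁ 1+u<1+n = inj₁ (sym (trans (toℕ-rotate 1 u) (trans (cong (_% suc n) (ℕ.+-comm (toℕ u) 1)) (m<n⇒m%n≡m 1+u<1+n))))
... | inj₂ 1+u≡1+n = inj₂ (ℕ.suc-injective 1+u≡1+n ,
  trans (toℕ-rotate 1 u) (trans (cong (_% suc n) (trans (ℕ.+-comm (toℕ u) 1) 1+u≡1+n)) (n%n≡0 (suc n))))

suc⇒rotate-1 : ∀ {n} {u v : Fin (suc n)} → suc (toℕ u) ≡ toℕ v → rotate 1 u ≡ v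
suc⇒rotate-1 {n} {u} {v} 1+u≡v = Fin.toℕ-injective (trans (toℕ-rotate 1 u)
  (trans (cong (_% suc n) (trans (ℕ.+-comm (toℕ u) 1) 1+u≡v)) (m<n⇒m%n≡m (Fin.toℕ<n v))))

module Triangles {n : ℕ} (T : Triangulation (suc (suc n))) where
  open Triangulation T

  V : Set
  V = Fin (suc (suc n))

  joined-sym : ∀ {u v} → Joined T u v → Joined T v u
  joined-sym (inj₁ (inj₁ s)) = inj₁ (inj₂ s)
  joined-sym (inj₁ (inj₂ s)) = inj₁ (inj₁ s)
  joined-sym {u} {v} (inj₂ d) = inj₂ (trans (symmetric v u) d)

  joined-irreflexive : ∀ {u} → ¬ Joined T u u
  joined-irreflexive (inj₂ d) = proj₁ (proper _ _ d) refl
  joined-irreflexive {u} (inj₁ s) with rotate-1 {u = u} {u} (Sum.[ id , id ] s)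
  ... | inj₁ 1+u≡u       = ℕ.1+n≢n 1+u≡u
  ... | inj₂ (u≡n , u≡0) with () ← trans (sym u≡0) u≡n

  -- A side has no vertices strictly on both of its sides, so it crosses nothing; a pair of
  -- diagonals is handled by `noncrossing`.
  joined-noncrossing : ∀ {u v x y} → Joined T u v → Joined T x y →
    u Fin.< x → x Fin.< v → ¬ (y Fin.< u ⊎ v Fin.< y)
  joined-noncrossing {u} {v} {x} {y} (inj₁ (inj₁ s)) xy u<x x<v _ with rotate-1 s
  ... | inj₁ 1+u≡v     = ℕ.<⇒≱ x<v (subst (ℕ._≤ toℕ x) 1+u≡v u<x)
  ... | inj₂ (_ , v≡0) = ℕ.n≮0 (subst (toℕ x ℕ.<_) v≡0 x<v)
  joined-noncrossing {u} {v} {x} {y} (inj₁ (inj₂ s)) xy u<x x<v y∉ with rotate-1 s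
  ... | inj₁ 1+v≡u     = ℕ.<-asym (ℕ.<-trans u<x x<v) (ℕ.≤-reflexive 1+v≡u)
  ... | inj₂ (v≡n , u≡0) with y∉
  ...   | inj₁ y<u = ℕ.n≮0 (subst (toℕ y ℕ.<_) u≡0 y<u)
  ...   | inj₂ v<y = ℕ.<⇒≱ v<y (subst (toℕ y ℕ.≤_) (sym v≡n) (Fin.toℕ≤pred[n] y))
  joined-noncrossing {u} {v} {x} {y} (inj₂ uv) (inj₁ (inj₁ s)) u<x x<v y∉ with rotate-1 s | y∉
  ... | inj₁ 1+x≡y     | inj₁ y<u = ℕ.<-asym u<x (ℕ.<-trans (ℕ.≤-reflexive 1+x≡y) y<u)
  ... | inj₁ 1+x≡y     | inj₂ v<y = ℕ.<⇒≱ v<y (subst (ℕ._≤ toℕ v) 1+x≡y x<v)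
  ... | inj₂ (x≡n , _) | _        = ℕ.<⇒≱ x<v (subst (toℕ v ℕ.≤_) (sym x≡n) (Fin.toℕ≤pred[n] v))
  joined-noncrossing {u} {v} {x} {y} (inj₂ uv) (inj₁ (inj₂ s)) u<x x<v y∉ with rotate-1 s | y∉
  ... | inj₁ 1+y≡x     | inj₁ y<u = ℕ.<⇒≱ u<x (subst (ℕ._≤ toℕ u) 1+y≡x y<u)
  ... | inj₁ 1+y≡x     | inj₂ v<y = ℕ.<-asym x<v (ℕ.<-trans v<y (ℕ.≤-reflexive 1+y≡x))
  ... | inj₂ (_ , x≡0) | _        = ℕ.n≮0 (subst (toℕ u ℕ.<_) x≡0 u<x)
  joined-noncrossing {u} {v} {x} {y} (inj₂ uv) (inj₂ xy) u<x x<v y∉ =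
    noncrossing u v x y uv xy (inj₁ (inj₁ (u<x , x<v) ,
      Sum.map (λ y<u → y<u , ℕ.<-trans y<u (ℕ.<-trans u<x x<v))
                   (λ v<y → ℕ.<-trans (ℕ.<-trans u<x x<v) v<y , v<y) y∉))

  module _ {u w v : V} (uv : Joined T u v) (uw : Joined T u w) (u<w : u Fin.< w) (w<v : w Fin.< v)
           (w-max : ∀ x → u Fin.< x × x Fin.< v × Joined T u x → x Fin.≤ w) where

    private
      uncrossed : ∀ {x y} → Joined T x y → w Fin.< x → x Fin.< v → ¬ (y Fin.< w ⊎ v Fin.< y)
      uncrossed {x} {y} xy w<x x<v (inj₂ v<y) = joined-noncrossing uv xy (ℕ.<-trans u<w w<x) x<v (inj₂ v<y)
      uncrossed {x} {y} xy w<x x<v (inj₁ y<w) with ℕ.<-cmp (toℕ y) (toℕ u)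
      ... | tri< y<u _ _ = joined-noncrossing uv xy (ℕ.<-trans u<w w<x) x<v (inj₁ y<u)
      ... | tri> _ _ u<y = joined-noncrossing uw (joined-sym xy) u<y y<w (inj₂ w<x)
      ... | tri≈ _ y≡u _ = ℕ.<⇒≱ w<x (w-max x
        (ℕ.<-trans u<w w<x , x<v , subst (λ y → Joined T y x) (Fin.toℕ-injective y≡u) (joined-sym xy)))
      inside : ∀ {x} → Inside w v x → w Fin.< x × x Fin.< v
      inside (inj₁ p)           = p
      inside (inj₂ (v<x , x<w)) = ⊥-elim (ℕ.<-asym w<v (ℕ.<-trans v<x x<w))
      outside : ∀ {y} → Outside w v y → y Fin.< w ⊎ v Fin.< y
      outside (inj₁ (y<w , _)) = inj₁ y<w
      outside (inj₂ (_ , v<y)) = inj₂ v<y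

    -- A chord crossing wv has one end x strictly between w and v. Its other end y cannot lie before
    -- u or after v because of uv, nor strictly between u and w because of uw, and y = u would make
    -- x a later neighbour of u than w. So nothing crosses wv, and maximality puts it in.
    last-neighbour-joined : Joined T w v
    last-neighbour-joined with ℕ.m≤n⇒m<n∨m≡n w<v
    ... | inj₂ 1+w≡v = inj₁ (inj₁ (suc⇒rotate-1 1+w≡v))
    ... | inj₁ 1+w<v = inj₂ (maximal w v (w≢v , w-v-not-side) uncrossed′)
      where
      w≢v : w ≢ v
      w≢v w≡v = ℕ.<-irrefl (cong toℕ w≡v) w<v
      w-v-not-side : ¬ Side w v
      w-v-not-side (inj₁ s) with rotate-1 s
      ... | inj₁ 1+w≡v     = ℕ.<-irrefl 1+w≡v 1+w<v
      ... | inj₂ (_ , v≡0) = ℕ.n≮0 (subst (toℕ w ℕ.<_) v≡0 w<v)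
      w-v-not-side (inj₂ s) with rotate-1 s
      ... | inj₁ 1+v≡w     = ℕ.<-asym w<v (ℕ.≤-reflexive 1+v≡w)
      ... | inj₂ (_ , w≡0) = ℕ.n≮0 (subst (toℕ u ℕ.<_) w≡0 u<w)
      uncrossed′ : ∀ x y → diagonal x y ≡ true → ¬ Cross w v x y
      uncrossed′ x y xy (inj₁ (x-in , y-out)) = let w<x , x<v = inside x-in in
        uncrossed (inj₂ xy) w<x x<v (outside y-out)
      uncrossed′ x y xy (inj₂ (y-in , x-out)) = let w<y , y<v = inside y-in in
        uncrossed (joined-sym (inj₂ xy)) w<y y<v (outside x-out)

  -- The apex is the last neighbour of u strictly before v; it exists because u + 1 is such a
  -- neighbour.
  third-vertex : ∀ {u v : V} → Joined T u v → suc (toℕ u) ℕ.< toℕ v →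
    ∃ λ w → u Fin.< w × w Fin.< v × Joined T u w × Joined T w v
  third-vertex {u} {v} uv 1+u<v
    with x , 1+u≡x ← toℕ-surjective (ℕ.<-trans 1+u<v (Fin.toℕ<n v))
    with w , (u<w , w<v , uw) , w-max ← maximum
      (λ w → u Fin.<? w ×-dec w Fin.<? v ×-dec Joined? T u w)
      (x , ℕ.≤-reflexive 1+u≡x , subst (ℕ._< toℕ v) 1+u≡x 1+u<v , inj₁ (inj₁ (suc⇒rotate-1 1+u≡x)))
    = w , u<w , w<v , uw , last-neighbour-joined uv uw u<w w<v w-max

  -- Counting the triangles of a subpolygon

  pairs : List (V × V)
  pairs = cartesianProduct (allFin (suc (suc n))) (allFin (suc (suc n)))

  ∈-pairs : ∀ p → p ∈ pairs
  ∈-pairs (v , w) = ∈-cartesianProduct⁺ (∈-allFin v) (∈-allFin w)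

  pairs-unique : Unique pairs
  pairs-unique = Unique.cartesianProduct⁺ (Unique.allFin⁺ (suc (suc n))) (Unique.allFin⁺ (suc (suc n)))

  # : {P : Pred (V × V) 0ℓ} → Decidable P → ℕ
  # P? = length (filter P? pairs)

  is? : (p : V × V) → Decidable (_≡ p)
  is? p q = ≡-dec Fin._≟_ Fin._≟_ q p

  #-single : ∀ p → # (is? p) ≡ 1
  #-single p = sym (length-bijection id (All.[] ∷ []) (Unique.filter⁺ (is? p) pairs-unique) id
    (λ { (here refl) → ∈-filter⁺ (is? p) (∈-pairs p) refl })
    (λ {q} q∈ → p , here refl , proj₂ (∈-filter⁻ (is? p) {xs = pairs} q∈)))

  Triangle : V → V × V → Set
  Triangle u (v , w) = v Fin.< w × Joined T u v × Joined T v w × Joined T u w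

  triangle? : ∀ u → Decidable (Triangle u)
  triangle? u (v , w) = v Fin.<? w ×-dec Joined? T u v ×-dec Joined? T v w ×-dec Joined? T u w

  -- The triangles at u, respectively at v, inside the polygon with vertices u, u + 1, …, v.
  Left Right : V → V → V × V → Set
  Left  u v (y , z) = Triangle u (y , z) × u Fin.< y × z Fin.≤ v
  Right u v (y , z) = Triangle v (y , z) × u Fin.≤ y × z Fin.< v

  left? : ∀ u v → Decidable (Left u v)
  left? u v (y , z) = triangle? u (y , z) ×-dec u Fin.<? y ×-dec z Fin.≤? v

  right? : ∀ u v → Decidable (Right u v)
  right? u v (y , z) = triangle? v (y , z) ×-dec u Fin.≤? y ×-dec z Fin.<? v

  #left #right : V → V → ℕ
  #left  u v = # (left? u v)
  #right u v = # (right? u v)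

  #left-side : ∀ u v → suc (toℕ u) ≡ toℕ v → #left u v ≡ 0
  #left-side u v 1+u≡v = cong length (filter-none (left? u v) (All.tabulate {xs = pairs} λ { {y , z} _ ((y<z , _) , u<y , z≤v) →
    ℕ.<⇒≱ (ℕ.<-≤-trans y<z z≤v) (subst (ℕ._≤ toℕ y) 1+u≡v u<y) }))

  #right-side : ∀ u v → suc (toℕ u) ≡ toℕ v → #right u v ≡ 0
  #right-side u v 1+u≡v = cong length (filter-none (right? u v) (All.tabulate {xs = pairs} λ { {y , z} _ ((y<z , _) , u≤y , z<v) →
    ℕ.<⇒≱ z<v (subst (ℕ._≤ toℕ z) 1+u≡v (ℕ.≤-<-trans u≤y y<z)) }))

  module _ {u w v : V} (u<w : u Fin.< w) (w<v : w Fin.< v)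
           (uv : Joined T u v) (uw : Joined T u w) (wv : Joined T w v) where

    -- Widening the subpolygon from uw to uv adds just the triangle u w v at u: any other new
    -- triangle would have an edge crossing uw or wv.
    #left-suc : #left u v ≡ #left u w ℕ.+ 1
    #left-suc = trans (length-filter-⊎ (left? u v) (left? u w) (is? (w , v)) split
        (λ (t , u<y , z≤w) → t , u<y , ℕ.≤-trans z≤w (ℕ.<⇒≤ w<v))
        (λ { refl → (w<v , uw , wv , uv) , u<w , ℕ.≤-refl })
        (λ { (_ , _ , z≤w) refl → ℕ.<⇒≱ w<v z≤w }) pairs)
      (cong (#left u w ℕ.+_) (#-single (w , v)))
      where
      split : ∀ {p} → Left u v p → Left u w p ⊎ p ≡ (w , v)
      split {y , z} (t@(y<z , uy , yz , uz) , u<y , z≤v) with ℕ.<-cmp (toℕ y) (toℕ w)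
      ... | tri> _ _ w<y = ⊥-elim (joined-noncrossing wv (joined-sym uy) w<y (ℕ.<-≤-trans y<z z≤v) (inj₁ u<w))
      ... | tri< y<w _ _ with toℕ z ℕ.≤? toℕ w
      ...   | yes z≤w = inj₁ (t , u<y , z≤w)
      ...   | no  z≰w = ⊥-elim (joined-noncrossing uw yz u<y y<w (inj₂ (ℕ.≰⇒> z≰w)))
      split {y , z} (t@(y<z , uy , yz , uz) , u<y , z≤v) | tri≈ _ y≡w _ with ℕ.m≤n⇒m<n∨m≡n z≤v
      ... | inj₂ z≡v = inj₂ (cong₂ _,_ (Fin.toℕ-injective y≡w) (Fin.toℕ-injective z≡v))
      ... | inj₁ z<v = ⊥-elim (joined-noncrossing wv (joined-sym uz) (subst (ℕ._< toℕ z) y≡w y<z) z<v (inj₁ u<w))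

    #right-suc : #right u v ≡ #right w v ℕ.+ 1
    #right-suc = trans (length-filter-⊎ (right? u v) (right? w v) (is? (u , w)) split
        (λ (t , w≤y , z<v) → t , ℕ.≤-trans (ℕ.<⇒≤ u<w) w≤y , z<v)
        (λ { refl → (u<w , joined-sym uv , uw , joined-sym wv) , ℕ.≤-refl , w<v })
        (λ { (_ , w≤y , _) refl → ℕ.<⇒≱ u<w w≤y }) pairs)
      (cong (#right w v ℕ.+_) (#-single (u , w)))
      where
      split : ∀ {p} → Right u v p → Right w v p ⊎ p ≡ (u , w)
      split {y , z} (t@(y<z , vy , yz , vz) , u≤y , z<v) with ℕ.<-cmp (toℕ z) (toℕ w)
      ... | tri< z<w _ _ = ⊥-elim (joined-noncrossing uw (joined-sym vz) (ℕ.≤-<-trans u≤y y<z) z<w (inj₂ w<v))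
      ... | tri> _ _ w<z with toℕ w ℕ.≤? toℕ y
      ...   | yes w≤y = inj₁ (t , w≤y , z<v)
      ...   | no  w≰y = ⊥-elim (joined-noncrossing wv (joined-sym yz) w<z z<v (inj₁ (ℕ.≰⇒> w≰y)))
      split {y , z} (t@(y<z , vy , yz , vz) , u≤y , z<v) | tri≈ _ z≡w _ with ℕ.m≤n⇒m<n∨m≡n u≤y
      ... | inj₂ u≡y = inj₂ (cong₂ _,_ (Fin.toℕ-injective (sym u≡y)) (Fin.toℕ-injective z≡w))
      ... | inj₁ u<y = ⊥-elim (joined-noncrossing uw (joined-sym vy) u<y (subst (toℕ y ℕ.<_) z≡w y<z) (inj₂ w<v))

    Right⊎Left : V × V → Set
    Right⊎Left p = Right u w p ⊎ Left w v p

    right⊎left? : Decidable Right⊎Left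
    right⊎left? p = right? u w p ⊎-dec left? w v p

    -- The edge uv confines the neighbours of w to the range from u to v. A triangle at w with one
    -- vertex on each side of w must be u w v, or its far edge would cross uw or wv; all others lie
    -- below uw or below wv.
    triangleCount-split : triangleCount T w ≡ #right u w ℕ.+ #left w v ℕ.+ 1
    triangleCount-split = begin
      # (triangle? w)
        ≡⟨ length-filter-⊎ (triangle? w) right⊎left? (is? (u , v)) split [ proj₁ , proj₁ ]
             (λ { refl → ℕ.<-trans u<w w<v , joined-sym uw , uv , wv })
             (λ { (inj₁ (_ , _ , v<w)) refl → ℕ.<-asym w<v v<w ; (inj₂ (_ , w<u , _)) refl → ℕ.<-asym u<w w<u }) pairs ⟩
      # right⊎left? ℕ.+ # (is? (u , v))
        ≡⟨ cong₂ ℕ._+_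
             (length-filter-⊎ right⊎left? (right? u w) (left? w v) id inj₁ inj₂
               (λ (( y<z , _) , _ , z<w) (_ , w<y , _) → ℕ.<-asym w<y (ℕ.<-trans y<z z<w)) pairs)
             (#-single (u , v)) ⟩
      #right u w ℕ.+ #left w v ℕ.+ 1 ∎
      where
      open ≡-Reasoning
      joined-bounds : ∀ {y} → Joined T w y → u Fin.≤ y × y Fin.≤ v
      joined-bounds wy = ℕ.≮⇒≥ (λ y<u → joined-noncrossing uv wy u<w w<v (inj₁ y<u)) ,
                         ℕ.≮⇒≥ (λ v<y → joined-noncrossing uv wy u<w w<v (inj₂ v<y))
      split : ∀ {p} → Triangle w p → Right⊎Left p ⊎ p ≡ (u , v)
      split {y , z} t@(y<z , wy , yz , wz) with ℕ.<-cmp (toℕ y) (toℕ w) | ℕ.<-cmp (toℕ z) (toℕ w)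
      ... | _            | tri< z<w _ _ = inj₁ (inj₁ (t , proj₁ (joined-bounds wy) , z<w))
      ... | tri> _ _ w<y | _            = inj₁ (inj₂ (t , w<y , proj₂ (joined-bounds wz)))
      ... | tri≈ _ y≡w _ | _            = ⊥-elim (joined-irreflexive (subst (Joined T w) (Fin.toℕ-injective y≡w) wy))
      ... | _            | tri≈ _ z≡w _ = ⊥-elim (joined-irreflexive (subst (Joined T w) (Fin.toℕ-injective z≡w) wz))
      ... | tri< y<w _ _ | tri> _ _ w<z = inj₂ (cong₂ _,_ (Fin.toℕ-injective (sym u≡y)) (Fin.toℕ-injective z≡v))
        where
        u≡y : toℕ u ≡ toℕ y
        u≡y with ℕ.m≤n⇒m<n∨m≡n (proj₁ (joined-bounds wy))
        ... | inj₂ u≡y = u≡y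
        ... | inj₁ u<y = ⊥-elim (joined-noncrossing uw yz u<y y<w (inj₂ w<z))
        z≡v : toℕ z ≡ toℕ v
        z≡v with ℕ.m≤n⇒m<n∨m≡n (proj₂ (joined-bounds wz))
        ... | inj₂ z≡v = z≡v
        ... | inj₁ z<v = ⊥-elim (joined-noncrossing wv (joined-sym yz) w<z z<v (inj₁ y<w))

-- Entries equal to 1 and diagonals

*-pos : ∀ {i j} → + 0 ℤ.< i → + 0 ℤ.< j → + 0 ℤ.< i * j
*-pos {+ suc _} {+ suc _} _ _ = +<+ (s≤s z≤n)
*-pos {+ 0} (+<+ ())
*-pos {+ suc _} {+ 0} _ (+<+ ())

-- The entry of the frieze with quiddity b that belongs to the vertices p ≤ q of the polygon.
chord : (ℕ → ℤ) → ℕ → ℕ → ℤ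
chord b p q = K (b ↑ suc p) (q ∸ p)

-- Chords become the 2 by 2 minors of a matrix with two rows, formed by two solutions of the
-- recurrence. Ptolemy's relation for arbitrary four vertices is then the Plücker relation.
chord-determinant : ∀ b {p q} → p ℕ.≤ q →
  chord b p q ≡ K b (suc p) * K (b ↑ 1) q - K b (suc q) * K (b ↑ 1) p
chord-determinant b {p} {q} p≤q = begin
  chord b p q
    ≡⟨ isolate (chord b p q) (K b (suc q) * K (b ↑ 1) p) ⟩
  (+ 1 * chord b p q + K b (suc q) * K (b ↑ 1) p) - K b (suc q) * K (b ↑ 1) p
    ≡⟨ cong (_- K b (suc q) * K (b ↑ 1) p) (sym ptolemy′) ⟩
  K b (suc p) * K (b ↑ 1) q - K b (suc q) * K (b ↑ 1) p ∎
  where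
  open ≡-Reasoning
  isolate : ∀ x y → x ≡ (+ 1 * x + y) - y
  isolate = solve-∀
  ptolemy′ : K b (suc p) * K (b ↑ 1) q ≡ + 1 * chord b p q + K b (suc q) * K (b ↑ 1) p
  ptolemy′ with eq ← ptolemy b 1 p (q ∸ p)
    rewrite ℕ.+-comm p 1 | ℕ.+-suc (q ∸ p) p | ℕ.m∸n+n≡m p≤q = eq

chord-ptolemy : ∀ b {p q r s} → p ℕ.≤ q → q ℕ.≤ r → r ℕ.≤ s →
  chord b p r * chord b q s ≡ chord b p q * chord b r s + chord b p s * chord b q r
chord-ptolemy b {p} {q} {r} {s} p≤q q≤r r≤s
  rewrite chord-determinant b p≤q | chord-determinant b q≤r | chord-determinant b r≤s
        | chord-determinant b (ℕ.≤-trans p≤q q≤r) | chord-determinant b (ℕ.≤-trans q≤r r≤s)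
        | chord-determinant b (ℕ.≤-trans p≤q (ℕ.≤-trans q≤r r≤s)) =
  plücker (K b (suc p)) (K b (suc q)) (K b (suc r)) (K b (suc s))
          (K (b ↑ 1) p) (K (b ↑ 1) q) (K (b ↑ 1) r) (K (b ↑ 1) s)
  where
  plücker : ∀ x₁ x₂ x₃ x₄ y₁ y₂ y₃ y₄ →
    (x₁ * y₃ - x₃ * y₁) * (x₂ * y₄ - x₄ * y₂) ≡
    (x₁ * y₂ - x₂ * y₁) * (x₃ * y₄ - x₄ * y₃) + (x₁ * y₄ - x₄ * y₁) * (x₂ * y₃ - x₃ * y₂)
  plücker = solve-∀

module Quiddity {n : ℕ} (T : Triangulation (suc (suc n))) (b : ℕ → ℤ)
                (count : ∀ v → b (toℕ v) ≡ + triangleCount T v) where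
  open Triangulation T
  open Triangles T

  module _ (X : ℕ → ℤ) (recurrence : ∀ k → X k + X (suc (suc k)) ≡ b (suc k) * X (suc k)) where

    private
      recurrence′ : ∀ {k} → 0 ℕ.< k → X (pred k) + X (suc k) ≡ b k * X k
      recurrence′ {suc k} _ = recurrence k

    -- Let u w v be the triangle below the edge uv.  Adding the relations for uw and
    -- wv at w and comparing with the recurrence at w gives X w = X u + X v.
    joined-recurrence : ∀ bound {u v} → u Fin.< v → toℕ v ℕ.≤ bound ℕ.+ toℕ u → Joined T u v →
      X (suc (toℕ u)) ≡ + #left u v * X (toℕ u) + X (toℕ v) ×
      X (pred (toℕ v)) ≡ + #right u v * X (toℕ v) + X (toℕ u)
    -- The induction is on a bound for v - u, since uw and wv both span fewer steps than uv.
    joined-recurrence zero u<v v≤u _ = ⊥-elim (ℕ.<⇒≱ u<v v≤u)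
    joined-recurrence (suc bound) {u} {v} u<v v≤ uv with ℕ.m≤n⇒m<n∨m≡n u<v
    ... | inj₂ 1+u≡v rewrite #left-side u v 1+u≡v | #right-side u v 1+u≡v | sym 1+u≡v =
      lemma (X (toℕ u)) (X (suc (toℕ u))) , lemma (X (suc (toℕ u))) (X (toℕ u))
      where
      lemma : ∀ x y → y ≡ + 0 * x + y
      lemma = solve-∀
    ... | inj₁ 1+u<v with w , u<w , w<v , uw , wv ← third-vertex uv 1+u<v
      with left₁ , right₁ ← joined-recurrence bound u<w (ℕ.s≤s⁻¹ (ℕ.≤-trans w<v v≤)) uw
         | left₂ , right₂ ← joined-recurrence bound w<v
             (ℕ.≤-trans v≤ (ℕ.≤-trans (ℕ.≤-reflexive (sym (ℕ.+-suc bound (toℕ u)))) (ℕ.+-monoʳ-≤ bound u<w))) wv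
      = left , right
      where
      open ≡-Reasoning
      U W Z R L : ℤ
      U = X (toℕ u)
      W = X (toℕ w)
      Z = X (toℕ v)
      R = + #right u w
      L = + #left w v
      middle : W ≡ U + Z
      middle = begin
        W                                                   ≡⟨ lemma₁ R L W ⟩
        (R + L + + 1) * W - R * W - L * W                   ≡⟨ cong (λ x → x * W - R * W - L * W) (sym b-w) ⟩
        b (toℕ w) * W - R * W - L * W                       ≡⟨ cong (λ x → x - R * W - L * W) (sym (recurrence′ (ℕ.≤-<-trans z≤n u<w))) ⟩
        X (pred (toℕ w)) + X (suc (toℕ w)) - R * W - L * W  ≡⟨ cong₂ (λ x y → x + y - R * W - L * W) right₁ left₂ ⟩
        (R * W + U) + (L * W + Z) - R * W - L * W           ≡⟨ lemma₂ U Z (R * W) (L * W) ⟩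
        U + Z ∎
        where
        b-w : b (toℕ w) ≡ R + L + + 1
        b-w = trans (count w) (cong +_ (triangleCount-split u<w w<v uv uw wv))
        lemma₁ : ∀ R L W → W ≡ (R + L + + 1) * W - R * W - L * W
        lemma₁ = solve-∀
        lemma₂ : ∀ U Z x y → (x + U) + (y + Z) - x - y ≡ U + Z
        lemma₂ = solve-∀
      left : X (suc (toℕ u)) ≡ + #left u v * U + Z
      left = begin
        X (suc (toℕ u))                  ≡⟨ left₁ ⟩
        + #left u w * U + W              ≡⟨ cong (λ x → + #left u w * U + x) middle ⟩
        + #left u w * U + (U + Z)        ≡⟨ lemma (+ #left u w) U Z ⟩
        (+ #left u w + + 1) * U + Z      ≡⟨ cong (λ k → + k * U + Z) (sym (#left-suc u<w w<v uv uw wv)) ⟩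
        + #left u v * U + Z              ∎
        where
        lemma : ∀ L U Z → L * U + (U + Z) ≡ (L + + 1) * U + Z
        lemma = solve-∀
      right : X (pred (toℕ v)) ≡ + #right u v * Z + U
      right = begin
        X (pred (toℕ v))                 ≡⟨ right₂ ⟩
        + #right w v * Z + W             ≡⟨ cong (λ x → + #right w v * Z + x) middle ⟩
        + #right w v * Z + (U + Z)       ≡⟨ lemma (+ #right w v) U Z ⟩
        (+ #right w v + + 1) * Z + U     ≡⟨ cong (λ k → + k * Z + U) (sym (#right-suc u<w w<v uv uw wv)) ⟩
        + #right u v * Z + U             ∎
        where
        lemma : ∀ R U Z → R * Z + (U + Z) ≡ (R + + 1) * Z + U
        lemma = solve-∀

  -- By `joined-recurrence`, both solutions in `chord-determinant` have their value at q equal to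
  -- that at p + 1 minus the same multiple of that at p. Hence the determinant for p, q equals the
  -- one for p, p + 1, which is 1.
  joined⇒chord : ∀ {u v} → u Fin.< v → Joined T u v → chord b (toℕ u) (toℕ v) ≡ + 1
  joined⇒chord {u} {v} u<v uv = begin
    chord b p q                                 ≡⟨ chord-determinant b (ℕ.<⇒≤ u<v) ⟩
    X p * Y q - X q * Y p                       ≡⟨ lemma₁ (X p) (X q) (Y p) (Y q) L ⟩
    X p * (L * Y p + Y q) - (L * X p + X q) * Y p
      ≡⟨ cong₂ (λ x y → X p * y - x * Y p) (sym (end X λ k → lemma₂ (X k) _)) (sym (end Y Y-recurrence)) ⟩
    X p * Y (suc p) - X (suc p) * Y p           ≡⟨ chord-determinant b (ℕ.n≤1+n p) ⟨
    chord b p (suc p)                           ≡⟨ cong (K (b ↑ suc p)) (ℕ.m+n∸n≡m 1 p) ⟩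
    + 1 ∎
    where
    open ≡-Reasoning
    p q : ℕ
    p = toℕ u
    q = toℕ v
    L : ℤ
    L = + #left u v
    X Y : ℕ → ℤ
    X k = K b (suc k)
    Y   = K (b ↑ 1)
    end : ∀ X → (∀ k → X k + X (suc (suc k)) ≡ b (suc k) * X (suc k)) → X (suc p) ≡ L * X p + X q
    end X recurrence = proj₁ (joined-recurrence X recurrence q u<v (ℕ.m≤m+n q p) uv)
    lemma₁ : ∀ x x′ y y′ L → x * y′ - x′ * y ≡ x * (L * y + y′) - (L * x + x′) * y
    lemma₁ = solve-∀
    lemma₂ : ∀ x y → x + (y - x) ≡ y
    lemma₂ = solve-∀
    Y-recurrence : ∀ k → Y k + Y (suc (suc k)) ≡ b (suc k) * Y (suc k)
    Y-recurrence k = trans (lemma₂ (Y k) _) (cong (λ i → b i * Y (suc k)) (ℕ.+-comm k 1))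

  module _ (chord-positive : ∀ {p q} → p ℕ.< q → q ℕ.< suc (suc n) → + 0 ℤ.< chord b p q) where

    private
      -- Ptolemy's relation would write 1 as a sum of two products of positive integers, which is at
      -- least 2.
      not-crossing : ∀ {x y z w : V} → x Fin.< y → y Fin.< z → z Fin.< w →
        chord b (toℕ x) (toℕ z) ≡ + 1 → chord b (toℕ y) (toℕ w) ≡ + 1 → ⊥
      not-crossing {x} {y} {z} {w} x<y y<z z<w xz yw =
        ℤ.<⇒≱ (+<+ ℕ.≤-refl) (subst (+ 2 ≤_) (sym one≡) (ℤ.+-mono-≤
          (ℤ.i<j⇒suc[i]≤j (*-pos (chord-positive x<y (Fin.toℕ<n y)) (chord-positive z<w (Fin.toℕ<n w))))
          (ℤ.i<j⇒suc[i]≤j (*-pos (chord-positive (ℕ.<-trans x<y (ℕ.<-trans y<z z<w)) (Fin.toℕ<n w)) (chord-positive y<z (Fin.toℕ<n z))))))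
        where
        one≡ : + 1 ≡ chord b (toℕ x) (toℕ y) * chord b (toℕ z) (toℕ w) + chord b (toℕ x) (toℕ w) * chord b (toℕ y) (toℕ z)
        one≡ = trans (cong₂ _*_ (sym xz) (sym yw)) (chord-ptolemy b (ℕ.<⇒≤ x<y) (ℕ.<⇒≤ y<z) (ℕ.<⇒≤ z<w))

    -- By Ptolemy's relation, two crossing chords cannot both have entry 1.
    chord⇒diagonal : ∀ {u v} → u Fin.< v → IsDiagonal u v → chord b (toℕ u) (toℕ v) ≡ + 1 → diagonal u v ≡ true
    chord⇒diagonal {u} {v} u<v u-v-diagonal uv = maximal u v u-v-diagonal λ
      { x y xy (inj₁ (x-in , y-out)) → uncrossed xy x-in y-out
      ; x y xy (inj₂ (y-in , x-out)) → uncrossed (trans (symmetric y x) xy) y-in x-out }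
      where
      uncrossed : ∀ {x y} → diagonal x y ≡ true → Inside u v x → ¬ Outside u v y
      uncrossed xy (inj₂ (v<x , x<u)) _ = ℕ.<-asym u<v (ℕ.<-trans v<x x<u)
      uncrossed {x} {y} xy (inj₁ (u<x , x<v)) (inj₁ (y<u , _)) =
        not-crossing y<u u<x x<v (joined⇒chord (ℕ.<-trans y<u u<x) (joined-sym (inj₂ xy))) uv
      uncrossed {x} {y} xy (inj₁ (u<x , x<v)) (inj₂ (_ , v<y)) =
        not-crossing u<x x<v v<y uv (joined⇒chord (ℕ.<-trans x<v v<y) (inj₂ xy))

-- Rotational symmetry

0≤i+∣i∣ : ∀ i → + 0 ≤ i + + ℤ.∣ i ∣
0≤i+∣i∣ (+ k)    = +≤+ z≤n
0≤i+∣i∣ -[1+ k ] = ℤ.≤-reflexive (sym (ℤ.n⊖n≡0 (suc k)))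

%-+ : ∀ i k n .{{_ : ℕ.NonZero n}} → (i % n ℕ.+ k) % n ≡ (i ℕ.+ k) % n
%-+ i k n = begin
  (i % n ℕ.+ k) % n             ≡⟨ %-distribˡ-+ (i % n) k n ⟩
  (i % n % n ℕ.+ k % n) % n     ≡⟨ cong (λ x → (x ℕ.+ k % n) % n) (m%n%n≡m%n i n) ⟩
  (i % n ℕ.+ k % n) % n         ≡⟨ %-distribˡ-+ i k n ⟨
  (i ℕ.+ k) % n                 ∎
  where open ≡-Reasoning

rotate-mod : ∀ {n} k i {u : Fin (suc n)} → i % suc n ≡ toℕ u → (i ℕ.+ k) % suc n ≡ toℕ (rotate k u)
rotate-mod {n} k i {u} i≡u = trans (sym (%-+ i k (suc n)))
  (trans (cong (λ x → (x ℕ.+ k) % suc n) i≡u) (sym (toℕ-rotate k u)))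

toℕ-% : ∀ {n} (u : Fin (suc n)) → toℕ u % suc n ≡ toℕ u
toℕ-% u = m<n⇒m%n≡m (Fin.toℕ<n u)

rotate-+ : ∀ {n} j k (u : Fin (suc n)) → rotate k (rotate j u) ≡ rotate (j ℕ.+ k) u
rotate-+ {n} j k u = Fin.toℕ-injective (trans
  (sym (rotate-mod k (toℕ u ℕ.+ j) (sym (toℕ-rotate j u))))
  (trans (cong (_% suc n) (ℕ.+-assoc (toℕ u) j k)) (sym (toℕ-rotate (j ℕ.+ k) u))))

rotate-comm : ∀ {n} j k (u : Fin (suc n)) → rotate k (rotate j u) ≡ rotate j (rotate k u)
rotate-comm j k u = trans (rotate-+ j k u) (trans (cong (λ i → rotate i u) (ℕ.+-comm j k)) (sym (rotate-+ k j u)))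

rotate-full : ∀ {n} (u : Fin (suc n)) → rotate (suc n) u ≡ u
rotate-full {n} u = Fin.toℕ-injective (trans (toℕ-rotate (suc n) u) (trans ([m+n]%n≡m%n (toℕ u) (suc n)) (toℕ-% u)))

rotate-inverseˡ : ∀ {n} (k u : Fin (suc n)) → rotate (suc n ∸ toℕ k) (rotate (toℕ k) u) ≡ u
rotate-inverseˡ {n} k u = trans (rotate-+ (toℕ k) (suc n ∸ toℕ k) u)
  (trans (cong (λ i → rotate i u) (ℕ.m+[n∸m]≡n (ℕ.<⇒≤ (Fin.toℕ<n k)))) (rotate-full u))

rotate-inverseʳ : ∀ {n} (k u : Fin (suc n)) → rotate (toℕ k) (rotate (suc n ∸ toℕ k) u) ≡ u
rotate-inverseʳ {n} k u = trans (rotate-comm (suc n ∸ toℕ k) (toℕ k) u) (rotate-inverseˡ k u)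

rotate-injective : ∀ {n} (k : Fin (suc n)) {u v} → rotate (toℕ k) u ≡ rotate (toℕ k) v → u ≡ v
rotate-injective {n} k {u} {v} eq = trans (sym (rotate-inverseˡ k u))
  (trans (cong (rotate (suc n ∸ toℕ k)) eq) (rotate-inverseˡ k v))

last⇒rotate-1 : ∀ {n} {u v : Fin (suc n)} → toℕ u ≡ n → toℕ v ≡ 0 → rotate 1 u ≡ v
last⇒rotate-1 {n} {u} u≡n v≡0 = Fin.toℕ-injective (trans (toℕ-rotate 1 u)
  (trans (cong (_% suc n) (trans (ℕ.+-comm (toℕ u) 1) (cong suc u≡n))) (trans (n%n≡0 (suc n)) (sym v≡0))))

module Rotation {n : ℕ} (T : Triangulation (suc (suc n))) (k : Fin (suc (suc n))) (preserves : Preserves T k) where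
  open Triangulation T
  open Triangles T

  private
    ρ : V → V
    ρ = rotate (toℕ k)

  joined-ρ⁺ : ∀ {u v} → Joined T u v → Joined T (ρ u) (ρ v)
  joined-ρ⁺ {u} {v} = Sum.map
    (Sum.map (λ s → trans (rotate-comm (toℕ k) 1 u) (cong ρ s)) (λ s → trans (rotate-comm (toℕ k) 1 v) (cong ρ s)))
    (λ d → trans (preserves u v) d)

  joined-ρ⁻ : ∀ {u v} → Joined T (ρ u) (ρ v) → Joined T u v
  joined-ρ⁻ {u} {v} = Sum.map
    (Sum.map (λ s → rotate-injective k (trans (sym (rotate-comm (toℕ k) 1 u)) s))
             (λ s → rotate-injective k (trans (sym (rotate-comm (toℕ k) 1 v)) s)))
    (λ d → trans (sym (preserves u v)) d)

  -- Triangles at u as ordered pairs of vertices: unlike the order v < w, this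
  -- notion is invariant under rotation.
  OrderedTriangle : V → V × V → Set
  OrderedTriangle u (v , w) = Joined T u v × Joined T v w × Joined T u w

  orderedTriangle? : ∀ u → Decidable (OrderedTriangle u)
  orderedTriangle? u (v , w) = Joined? T u v ×-dec Joined? T v w ×-dec Joined? T u w

  #orderedTriangle : ∀ u → # (orderedTriangle? u) ≡ triangleCount T u ℕ.+ triangleCount T u
  #orderedTriangle u = trans
    (length-filter-⊎ (orderedTriangle? u) (triangle? u) (triangle? u ∘ swap) split
      proj₂ (λ (_ , uw , wv , uv) → uv , joined-sym wv , uw) (λ (v<w , _) (w<v , _) → ℕ.<-asym v<w w<v) pairs)
    (cong (triangleCount T u ℕ.+_) (length-bijection swap
      (Unique.filter⁺ (triangle? u ∘ swap) pairs-unique) (Unique.filter⁺ (triangle? u) pairs-unique)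
      (cong swap)
      (λ {p} p∈ → ∈-filter⁺ (triangle? u) (∈-pairs (swap p)) (proj₂ (∈-filter⁻ (triangle? u ∘ swap) {xs = pairs} p∈)))
      (λ {p} p∈ → swap p , ∈-filter⁺ (triangle? u ∘ swap) (∈-pairs (swap p)) (proj₂ (∈-filter⁻ (triangle? u) {xs = pairs} p∈)) , refl)))
    where
    split : ∀ {p} → OrderedTriangle u p → Triangle u p ⊎ Triangle u (swap p)
    split {v , w} (uv , vw , uw) with ℕ.<-cmp (toℕ v) (toℕ w)
    ... | tri< v<w _ _ = inj₁ (v<w , uv , vw , uw)
    ... | tri> _ _ w<v = inj₂ (w<v , uw , joined-sym vw , uv)
    ... | tri≈ _ v≡w _ = ⊥-elim (joined-irreflexive (subst (Joined T v) (sym (Fin.toℕ-injective v≡w)) vw))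

  -- The rotation maps the ordered triangles at u bijectively to those at its image, and these are
  -- twice the triangles.
  triangleCount-rotate : ∀ u → triangleCount T (ρ u) ≡ triangleCount T u
  triangleCount-rotate u = halve (begin
    triangleCount T (ρ u) ℕ.+ triangleCount T (ρ u)   ≡⟨ #orderedTriangle (ρ u) ⟨
    # (orderedTriangle? (ρ u))                        ≡⟨ rotated ⟨
    # (orderedTriangle? u)                            ≡⟨ #orderedTriangle u ⟩
    triangleCount T u ℕ.+ triangleCount T u           ∎)
    where
    open ≡-Reasoning
    halve : ∀ {x y} → x ℕ.+ x ≡ y ℕ.+ y → x ≡ y
    halve {x} {y} eq = ℕ.*-cancelˡ-≡ x y 2 (trans (cong (x ℕ.+_) (ℕ.+-identityʳ x)) (trans eq (cong (y ℕ.+_) (sym (ℕ.+-identityʳ y)))))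
    ρ² : V × V → V × V
    ρ² (v , w) = ρ v , ρ w
    ρ⁻¹ : V → V
    ρ⁻¹ = rotate (suc (suc n) ∸ toℕ k)
    rotated : # (orderedTriangle? u) ≡ # (orderedTriangle? (ρ u))
    rotated = length-bijection ρ²
      (Unique.filter⁺ (orderedTriangle? u) pairs-unique) (Unique.filter⁺ (orderedTriangle? (ρ u)) pairs-unique)
      (λ eq → cong₂ _,_ (rotate-injective k (cong proj₁ eq)) (rotate-injective k (cong proj₂ eq)))
      (λ {p} p∈ → let uv , vw , uw = proj₂ (∈-filter⁻ (orderedTriangle? u) {xs = pairs} p∈) in
        ∈-filter⁺ (orderedTriangle? (ρ u)) (∈-pairs (ρ² p)) (joined-ρ⁺ uv , joined-ρ⁺ vw , joined-ρ⁺ uw))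
      (λ {p} p∈ → preimage p (proj₂ (∈-filter⁻ (orderedTriangle? (ρ u)) {xs = pairs} p∈)))
      where
      preimage : ∀ p → OrderedTriangle (ρ u) p → ∃ λ q → q ∈ filter (orderedTriangle? u) pairs × p ≡ ρ² q
      preimage (v , w) (uv , vw , uw) = (ρ⁻¹ v , ρ⁻¹ w) ,
        ∈-filter⁺ (orderedTriangle? u) (∈-pairs (ρ⁻¹ v , ρ⁻¹ w))
          ( joined-ρ⁻ (subst (Joined T (ρ u)) v≡ uv)
          , joined-ρ⁻ (subst₂ (Joined T) v≡ w≡ vw)
          , joined-ρ⁻ (subst (Joined T (ρ u)) w≡ uw)) ,
        cong₂ _,_ v≡ w≡
        where
        v≡ : v ≡ ρ (ρ⁻¹ v)
        v≡ = sym (rotate-inverseʳ k v)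
        w≡ : w ≡ ρ (ρ⁻¹ w)
        w≡ = sym (rotate-inverseʳ k w)

-- Symmetries of the triangulation as shifts of the quiddity

module Symmetry {m : ℕ} (F : Frieze (suc (suc m))) (T : Triangulation (suc (suc m))) (associated : Associated F T) where
  open Triangulation T
  open Triangles T
  open Periods F

  b : ℕ → ℤ
  b = from (+ 1)

  open Quiddity T b associated

  b-shift : ∀ {q} → Shift q → ∀ j → b (j ℕ.+ q) ≡ b j
  b-shift shift j = shift (+ suc j)

  b↑ : ∀ i k → (b ↑ suc i) k ≡ from (+ suc (suc i)) k
  b↑ i k = from-↑ (+ 1) (suc i) k

  chord-positive : ∀ {p q} → p ℕ.< q → q ℕ.< n → + 0 ℤ.< chord b p q
  chord-positive {p} {q} p<q q<n with q ∸ p in eq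
  ... | zero  = ⊥-elim (ℕ.<⇒≱ p<q (ℕ.m∸n≡0⇒m≤n eq))
  ... | suc k = subst (+ 0 ℤ.<_) (sym (K-cong (b↑ p) (suc k)))
    (K-positive (+ suc (suc p)) {k} (ℕ.≤-trans (ℕ.≤-reflexive (sym eq)) (ℕ.≤-trans (ℕ.m∸n≤m q p) (ℕ.s≤s⁻¹ q<n))))

  -- Here i and i + k are vertices of the universal cover of the polygon, and
  -- 1 < k < n - 1 says that they are not adjacent.
  UnitChord : V → V → Set
  UnitChord u v = ∃₂ λ i k → 1 ℕ.< k × suc k ℕ.< n ×
    i % n ≡ toℕ u × (i ℕ.+ k) % n ≡ toℕ v × K (b ↑ suc i) k ≡ + 1

  -- The complementary arc starts at i + k and has n - k steps; `glide` gives it the same entry.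
  unitChord-sym : ∀ {u v} → UnitChord u v → UnitChord v u
  unitChord-sym (i , k , 1<k , 1+k<n , i≡u , i+k≡v , unit) =
    i ℕ.+ k , n ∸ k ,
    ℕ.+-cancelʳ-< k 1 (n ∸ k) (subst (suc k ℕ.<_) (sym (ℕ.m∸n+n≡m k≤n)) 1+k<n) ,
    ℕ.≤-trans (ℕ.+-monoˡ-≤ (n ∸ k) 1<k) (ℕ.≤-reflexive (ℕ.m+[n∸m]≡n k≤n)) ,
    i+k≡v ,
    trans (cong (_% n) (trans (ℕ.+-assoc i k (n ∸ k)) (cong (i ℕ.+_) (ℕ.m+[n∸m]≡n k≤n)))) (trans ([m+n]%n≡m%n i n) i≡u) ,
    trans (K-cong (b↑ (i ℕ.+ k)) (n ∸ k))
      (trans (sym (glide (+ suc (suc i)) k (n ∸ k) (ℕ.m∸n+n≡m k≤n))) (trans (sym (K-cong (b↑ i) k)) unit))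
    where
    k≤n : k ℕ.≤ n
    k≤n = ℕ.<⇒≤ (ℕ.<⇒≤ 1+k<n)

  -- In the universal cover a rotation is the translation of i by q, with k unchanged and no
  -- wrap-around to distinguish.
  unitChord-rotate : ∀ {q} → Shift q → ∀ {u v} → UnitChord u v → UnitChord (rotate q u) (rotate q v)
  unitChord-rotate {q} shift (i , k , 1<k , 1+k<n , i≡u , i+k≡v , unit) =
    i ℕ.+ q , k , 1<k , 1+k<n , rotate-mod q i i≡u ,
    trans (cong (_% n) swap-last) (rotate-mod q (i ℕ.+ k) i+k≡v) ,
    trans (K-cong (λ l → trans (cong b (sym (ℕ.+-assoc l (suc i) q))) (b-shift shift (l ℕ.+ suc i))) k) unit
    where
    swap-last : i ℕ.+ q ℕ.+ k ≡ i ℕ.+ k ℕ.+ q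
    swap-last = trans (ℕ.+-assoc i q k) (trans (cong (i ℕ.+_) (ℕ.+-comm q k)) (sym (ℕ.+-assoc i k q)))

  private
    ascending⇒unitChord : ∀ {u v} → u Fin.< v → diagonal u v ≡ true → UnitChord u v
    ascending⇒unitChord {u} {v} u<v uv = toℕ u , toℕ v ∸ toℕ u , 1<v-u , s≤s v-u<1+m , toℕ-% u ,
      trans (cong (_% n) (ℕ.m+[n∸m]≡n (ℕ.<⇒≤ u<v))) (toℕ-% v) , joined⇒chord u<v (inj₂ uv)
      where
      not-side : ¬ Side u v
      not-side = proj₂ (proper u v uv)
      1<v-u : 1 ℕ.< toℕ v ∸ toℕ u
      1<v-u with ℕ.m≤n⇒m<n∨m≡n u<v
      ... | inj₁ 1+u<v = ℕ.m+n≤o⇒m≤o∸n 2 1+u<v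
      ... | inj₂ 1+u≡v = ⊥-elim (not-side (inj₁ (suc⇒rotate-1 1+u≡v)))
      v-u<1+m : toℕ v ∸ toℕ u ℕ.< suc m
      v-u<1+m with ℕ.m≤n⇒m<n∨m≡n (Fin.toℕ≤pred[n] v) | ℕ.m≤n⇒m<n∨m≡n (z≤n {toℕ u})
      ... | inj₁ v<1+m | _        = ℕ.≤-<-trans (ℕ.m∸n≤m (toℕ v) (toℕ u)) v<1+m
      ... | inj₂ v≡1+m | inj₁ 0<u = subst (toℕ v ∸ toℕ u ℕ.<_) v≡1+m (ℕ.∸-monoʳ-< 0<u (ℕ.<⇒≤ u<v))
      ... | inj₂ v≡1+m | inj₂ 0≡u = ⊥-elim (not-side (inj₂ (last⇒rotate-1 v≡1+m (sym 0≡u))))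

  diagonal⇒unitChord : ∀ {u v} → diagonal u v ≡ true → UnitChord u v
  diagonal⇒unitChord {u} {v} uv with ℕ.<-cmp (toℕ u) (toℕ v)
  ... | tri< u<v _ _ = ascending⇒unitChord u<v uv
  ... | tri≈ _ u≡v _ = ⊥-elim (proj₁ (proper u v uv) (Fin.toℕ-injective u≡v))
  ... | tri> _ _ v<u = unitChord-sym (ascending⇒unitChord v<u (trans (symmetric v u) uv))

  private
    UnitChordFrom : V → V → Set
    UnitChordFrom u v = ∃ λ k → 1 ℕ.< k × suc k ℕ.< n × (toℕ u ℕ.+ k) % n ≡ toℕ v × K (b ↑ suc (toℕ u)) k ≡ + 1

    -- Since the quiddity is n-periodic, i may be replaced by its representative below n.
    unitChordFrom : ∀ {u v} → UnitChord u v → UnitChordFrom u v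
    unitChordFrom {u} {v} (i , k , 1<k , 1+k<n , i≡u , i+k≡v , unit) = k , 1<k , 1+k<n ,
      trans (cong (λ x → (x ℕ.+ k) % n) (sym i≡u)) (trans (%-+ i k n) i+k≡v) ,
      trans (sym (K-cong (λ l → trans (cong b (index l)) (b-shift (shift-* (i / n) n quiddity-periodic) (l ℕ.+ suc (toℕ u)))) k)) unit
      where
      index : ∀ l → l ℕ.+ suc i ≡ l ℕ.+ suc (toℕ u) ℕ.+ (i / n) ℕ.* n
      index l = trans (cong (λ x → l ℕ.+ suc x) (trans (m≡m%n+[m/n]*n i n) (cong (ℕ._+ (i / n) ℕ.* n) i≡u)))
        (sym (ℕ.+-assoc l (suc (toℕ u)) ((i / n) ℕ.* n)))

    ascending⇒diagonal : ∀ {u v k} → toℕ u ℕ.+ k ≡ toℕ v → 1 ℕ.< k → suc k ℕ.< n →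
      K (b ↑ suc (toℕ u)) k ≡ + 1 → diagonal u v ≡ true
    ascending⇒diagonal {u} {v} {k} u+k≡v 1<k 1+k<n unit =
      chord⇒diagonal chord-positive u<v ((λ u≡v → ℕ.<-irrefl (cong toℕ u≡v) u<v) , not-side)
        (trans (cong (λ q → K (b ↑ suc (toℕ u)) (q ∸ toℕ u)) (sym u+k≡v))
          (trans (cong (K (b ↑ suc (toℕ u))) (ℕ.m+n∸m≡n (toℕ u) k)) unit))
      where
      u<v : u Fin.< v
      u<v = subst (toℕ u ℕ.<_) u+k≡v (ℕ.m<m+n (toℕ u) (ℕ.<-trans (s≤s z≤n) 1<k))
      not-side : ¬ Side u v
      not-side (inj₁ s) with rotate-1 s
      ... | inj₁ 1+u≡v     = ℕ.<-irrefl (ℕ.+-cancelˡ-≡ (toℕ u) 1 k (trans (ℕ.+-comm (toℕ u) 1) (trans 1+u≡v (sym u+k≡v)))) 1<k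
      ... | inj₂ (_ , v≡0) = ℕ.n≮0 (subst (toℕ u ℕ.<_) v≡0 u<v)
      not-side (inj₂ s) with rotate-1 s
      ... | inj₁ 1+v≡u       = ℕ.<-asym u<v (ℕ.≤-reflexive 1+v≡u)
      ... | inj₂ (v≡ , u≡0) = ℕ.<-irrefl (cong suc (trans (cong (ℕ._+ k) (sym u≡0)) (trans u+k≡v v≡))) 1+k<n

  unitChord⇒diagonal : ∀ {u v} → UnitChord u v → diagonal u v ≡ true
  unitChord⇒diagonal {u} {v} uv@(i , k , _ , 1+k<n , _) with toℕ u ℕ.+ k ℕ.<? n
  ... | yes u+k<n =
    let _ , 1<k , 1+k<n , u+k≡v , unit = unitChordFrom uv in
    ascending⇒diagonal (trans (sym (m<n⇒m%n≡m u+k<n)) u+k≡v) 1<k 1+k<n unit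
  -- The arc from u to v passes vertex 0, so v precedes u, and the complementary arc from v to u is
  -- an ascending one.
  ... | no  u+k≮n =
    let _ , 1<l , 1+l<n , _ , unit = unitChordFrom (unitChord-sym uv) in
    trans (symmetric u v) (ascending⇒diagonal v+l≡u 1<l 1+l<n unit)
    where
    open ≡-Reasoning
    k≤n : k ℕ.≤ n
    k≤n = ℕ.<⇒≤ (ℕ.<⇒≤ 1+k<n)
    excess : ℕ
    excess = toℕ u ℕ.+ k ∸ n
    excess+n≡ : excess ℕ.+ n ≡ toℕ u ℕ.+ k
    excess+n≡ = ℕ.m∸n+n≡m (ℕ.≮⇒≥ u+k≮n)
    excess<n : excess ℕ.< n
    excess<n = ℕ.+-cancelʳ-< n excess n (subst (ℕ._< n ℕ.+ n) (sym excess+n≡) (ℕ.+-mono-<-≤ (Fin.toℕ<n u) k≤n))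
    v≡excess : toℕ v ≡ excess
    v≡excess = begin
      toℕ v               ≡⟨ proj₁ (proj₂ (proj₂ (proj₂ (unitChordFrom uv)))) ⟨
      (toℕ u ℕ.+ k) % n   ≡⟨ cong (_% n) excess+n≡ ⟨
      (excess ℕ.+ n) % n  ≡⟨ [m+n]%n≡m%n excess n ⟩
      excess % n          ≡⟨ m<n⇒m%n≡m excess<n ⟩
      excess              ∎
    v+l≡u : toℕ v ℕ.+ (n ∸ k) ≡ toℕ u
    v+l≡u = ℕ.+-cancelʳ-≡ k _ _ (begin
      toℕ v ℕ.+ (n ∸ k) ℕ.+ k    ≡⟨ ℕ.+-assoc (toℕ v) (n ∸ k) k ⟩
      toℕ v ℕ.+ (n ∸ k ℕ.+ k)    ≡⟨ cong₂ ℕ._+_ v≡excess (ℕ.m∸n+n≡m k≤n) ⟩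
      excess ℕ.+ n               ≡⟨ excess+n≡ ⟩
      toℕ u ℕ.+ k                ∎)

  -- Diagonals are exactly the unit chords, and these are carried along by shifts. For the opposite
  -- implication the inverse rotation is used; n-periodicity makes n - k a shift too.
  shift⇒preserves : ∀ k → Shift (toℕ k) → Preserves T k
  shift⇒preserves k shift u v = Bool.⇔→≡ {z = true} (mk⇔
    (λ uv → unitChord⇒diagonal (subst₂ UnitChord (rotate-inverseˡ k u) (rotate-inverseˡ k v)
      (unitChord-rotate shift⁻¹ (diagonal⇒unitChord uv))))
    (λ uv → unitChord⇒diagonal (unitChord-rotate shift (diagonal⇒unitChord uv))))
    where
    shift⁻¹ : Shift (n ∸ toℕ k)
    shift⁻¹ = shift-cancelˡ (toℕ k) (n ∸ toℕ k) shift
      (subst Shift (sym (ℕ.m+[n∸m]≡n (ℕ.<⇒≤ (Fin.toℕ<n k)))) quiddity-periodic)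

  -- A symmetry preserves the triangle counts, which are the quiddity at 1, ..., n; n-periodicity
  -- extends this to all integers.
  preserves⇒shift : ∀ k → Preserves T k → Shift (toℕ k)
  preserves⇒shift k preserves i = begin
    quiddity (i + + q)             ≡⟨ multiple (i + + q) ⟨
    quiddity (i + + q + + N)       ≡⟨ cong quiddity (lemma₁ i (+ q) (+ N)) ⟩
    quiddity (i + + N + + q)       ≡⟨ cong (λ x → quiddity (x + + q)) i+N≡ ⟩
    b (j ℕ.+ q)                    ≡⟨ b-% (j ℕ.+ q) ⟩
    b ((j ℕ.+ q) % n)              ≡⟨ cong b (rotate-mod q j (sym toℕ-u)) ⟩
    b (toℕ (rotate q u))           ≡⟨ associated (rotate q u) ⟩
    + triangleCount T (rotate q u) ≡⟨ cong +_ (triangleCount-rotate u) ⟩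
    + triangleCount T u            ≡⟨ associated u ⟨
    b (toℕ u)                      ≡⟨ cong b toℕ-u ⟩
    b (j % n)                      ≡⟨ b-% j ⟨
    b j                            ≡⟨ cong quiddity i+N≡ ⟨
    quiddity (i + + N)             ≡⟨ multiple i ⟩
    quiddity i                     ∎
    where
    open ≡-Reasoning
    open Rotation T k preserves
    q N j : ℕ
    q = toℕ k
    -- A multiple of n large enough that i + N is at least 1; the index j below is one less because
    -- vertices are numbered from 0.
    N = suc ℤ.∣ i ∣ ℕ.* n
    j = ℤ.∣ i + + N - + 1 ∣
    multiple : ∀ i → quiddity (i + + N) ≡ quiddity i
    multiple = shift-* (suc ℤ.∣ i ∣) n quiddity-periodic
    lemma₁ : ∀ i q N → i + q + N ≡ i + N + q
    lemma₁ = solve-∀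
    lemma₂ : ∀ x → x ≡ + 1 + (x - + 1)
    lemma₂ = solve-∀
    1≤i+N : + 1 ≤ i + + N
    1≤i+N = ℤ.≤-trans (ℤ.+-monoˡ-≤ (+ 1) (0≤i+∣i∣ i)) (ℤ.≤-trans
      (ℤ.≤-reflexive (trans (ℤ.+-assoc i (+ ℤ.∣ i ∣) (+ 1)) (cong (λ x → i + + x) (ℕ.+-comm ℤ.∣ i ∣ 1))))
      (ℤ.+-monoʳ-≤ i (+≤+ (ℕ.m≤m*n (suc ℤ.∣ i ∣) n))))
    i+N≡ : i + + N ≡ + suc j
    i+N≡ = trans (lemma₂ (i + + N)) (cong (λ x → + 1 + x) (sym (ℤ.0≤i⇒+∣i∣≡i (ℤ.i≤j⇒0≤j-i 1≤i+N))))
    u : V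
    u = j mod n
    toℕ-u : toℕ u ≡ j % n
    toℕ-u = Fin.toℕ-fromℕ< _
    b-% : ∀ j → b j ≡ b (j % n)
    b-% j = trans (cong b (m≡m%n+[m/n]*n j n)) (b-shift (shift-* (j / n) n quiddity-periodic) (j % n))

  module _ (p : ℕ) (minimal : IsMinimalPeriod F (suc p)) where
    open Minimal p minimal

    -- The rotation by k is a symmetry exactly when k is a shift, that is, a multiple of the minimal
    -- period; d such multiples lie below n.
    rotationalSymmetryOrder≡ : ∀ d → n ≡ d ℕ.* suc p → rotationalSymmetryOrder T ≡ d
    rotationalSymmetryOrder≡ d n≡ = trans (sym (length-bijection multiple (Unique.allFin⁺ d)
        (Unique.filter⁺ (Preserves? T) (Unique.allFin⁺ n)) multiple-injective
        (λ {j} _ → ∈-filter⁺ (Preserves? T) (∈-allFin (multiple j)) (multiple-preserves j))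
        (λ {k} k∈ → preimage k (shift⇒∣ (preserves⇒shift k (proj₂ (∈-filter⁻ (Preserves? T) {xs = allFin n} k∈)))))))
      (length-tabulate id)
      where
      bound : ∀ (j : Fin d) → toℕ j ℕ.* suc p ℕ.< n
      bound j = subst (toℕ j ℕ.* suc p ℕ.<_) (sym n≡) (ℕ.*-monoˡ-< (suc p) (Fin.toℕ<n j))
      multiple : Fin d → Fin n
      multiple j = Fin.fromℕ< (bound j)
      toℕ-multiple : ∀ j → toℕ (multiple j) ≡ toℕ j ℕ.* suc p
      toℕ-multiple j = Fin.toℕ-fromℕ< (bound j)
      multiple-injective : ∀ {i j} → multiple i ≡ multiple j → i ≡ j
      multiple-injective {i} {j} eq = Fin.toℕ-injective (ℕ.*-cancelʳ-≡ (toℕ i) (toℕ j) (suc p)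
        (trans (sym (toℕ-multiple i)) (trans (cong toℕ eq) (toℕ-multiple j))))
      multiple-preserves : ∀ j → Preserves T (multiple j)
      multiple-preserves j = shift⇒preserves (multiple j)
        (subst Shift (sym (toℕ-multiple j)) (shift-* (toℕ j) (suc p) shift-p))
      preimage : ∀ k → suc p ∣ toℕ k → ∃ λ j → j ∈ allFin d × k ≡ multiple j
      preimage k (divides j k≡) = j′ , ∈-allFin j′ , Fin.toℕ-injective (begin
        toℕ k                ≡⟨ k≡ ⟩
        j ℕ.* suc p          ≡⟨ cong (ℕ._* suc p) (Fin.toℕ-fromℕ< j<d) ⟨
        toℕ j′ ℕ.* suc p     ≡⟨ toℕ-multiple j′ ⟨
        toℕ (multiple j′)    ∎)
        where
        open ≡-Reasoning
        j<d : j ℕ.< d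
        j<d = ℕ.*-cancelʳ-< (suc p) j d (subst₂ ℕ._<_ k≡ n≡ (Fin.toℕ<n k))
        j′ : Fin d
        j′ = Fin.fromℕ< j<d

-- The growth coefficient as a function of the symmetry order

growth-coefficient : ∀ {n} (F : Frieze n) (s₁ : ℤ) → IsPrincipalGrowthCoefficient F s₁ →
  ∃ λ d → s₁ ≡ coefficient d × (∀ T → Associated F T → rotationalSymmetryOrder T ≡ d)
growth-coefficient {0} F with () ← Frieze.order≥3 F
growth-coefficient {1} F with s≤s () ← Frieze.order≥3 F
growth-coefficient {suc (suc m)} F _ (zero  , L , ((() , _) , _) , _)
-- The number d is the order divided by the minimal period. It is chosen before any triangulation,
-- so the possible values of the coefficient follow from the frieze alone.
growth-coefficient {suc (suc m)} F _ (suc p , L , minimal , refl)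
  with divides d n≡ ← Periods.Minimal.shift⇒∣ F p minimal (Continuants.quiddity-periodic F) =
  d , Periods.Minimal.growth F p minimal L d n≡ ,
  λ T associated → Symmetry.rotationalSymmetryOrder≡ F T associated p minimal d n≡

coefficient-values : ∀ d → coefficient d ≡ - (+ 2) ⊎ coefficient d ≡ + 0 ⊎ coefficient d ≡ + 1
coefficient-values 0 = inj₂ (inj₂ refl)
coefficient-values 1 = inj₁ refl
coefficient-values 2 = inj₂ (inj₁ refl)
coefficient-values (suc (suc (suc _))) = inj₂ (inj₂ refl)

proposition4p1 : (∀ {n : ℕ} (F : Frieze n) (s₁ : ℤ) → IsPrincipalGrowthCoefficient F s₁ →
    s₁ ≡ - (+ 2) ⊎ s₁ ≡ + 0 ⊎ s₁ ≡ + 1)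
    ×
    (∀ {n n′ : ℕ} (F : Frieze n) (F′ : Frieze n′)
    (T : Triangulation n) (T′ : Triangulation n′) (s₁ s₁′ : ℤ) →
    Associated F T → Associated F′ T′ →
    IsPrincipalGrowthCoefficient F s₁ → IsPrincipalGrowthCoefficient F′ s₁′ →
    rotationalSymmetryOrder T ≡ rotationalSymmetryOrder T′ →
    s₁ ≡ s₁′)
proposition4p1 = value , determined
  where
  value : ∀ {n : ℕ} (F : Frieze n) (s₁ : ℤ) → IsPrincipalGrowthCoefficient F s₁ →
    s₁ ≡ - (+ 2) ⊎ s₁ ≡ + 0 ⊎ s₁ ≡ + 1
  value F s₁ growth with d , refl , _ ← growth-coefficient F s₁ growth = coefficient-values d

  determined : ∀ {n n′ : ℕ} (F : Frieze n) (F′ : Frieze n′)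
    (T : Triangulation n) (T′ : Triangulation n′) (s₁ s₁′ : ℤ) →
    Associated F T → Associated F′ T′ →
    IsPrincipalGrowthCoefficient F s₁ → IsPrincipalGrowthCoefficient F′ s₁′ →
    rotationalSymmetryOrder T ≡ rotationalSymmetryOrder T′ → s₁ ≡ s₁′
  determined F F′ T T′ s₁ s₁′ assoc assoc′ growth growth′ order≡
    with d , refl , order ← growth-coefficient F s₁ growth
       | d′ , refl , order′ ← growth-coefficient F′ s₁′ growth′ =
    cong coefficient (trans (sym (order T assoc)) (trans order≡ (order′ T′ assoc′)))
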